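{- Let $p$ be a prime number. Suppose that a pro-$p$ group $G$ is one of the following: (i) a generalized right-angled Artin pro-$p$ group; (ii) $p=2$ and $G$ is a $\Delta$-right-angled Artin pro-$2$ group. Then $G$ has the $p$-Kijima--Nishi property.
   Context: For a profinite group $G$, $\mathrm{H}^n(G,\mathbb{F}_p)$ is continuous cohomology with trivial coefficients and $$\mathcal{R}_p(G)=\{\alpha\in \mathrm{H}^1(G,\mathbb{F}_p) : \alpha\smile\beta=0 \text{ for all }\beta\in \mathrm{H}^1(G,\mathbb{F}_p)\}.$$ For an open subgroup $U\le G$, corestriction maps $\mathcal{R}_p(U)$ into $\mathcal{R}_p(G)$, inducing $c_{U,G}:\mathcal{R}_p(U)\to\mathcal{R}_p(G)$. $G$ has the $p$-Kijima--Nishi property if $c_{U,G}$ is surjective for every open normal subgroup $U$ of index $p$. Generalized right-angled Artin pro-$p$ groups: let $\Gamma=(V,E)$ be a finite combinatorial directed graph, i.e. $V$ is a finite set and $E\subseteq V\times V$ is such that $(v,w)\in E$ implies $(w,v)\notin E$ (in particular no loops). Let $f:E\to p\mathbb{Z}_p\times p\mathbb{Z}_p$ if $p$ is odd, $f:E\to 4\mathbb{Z}_2\times 4\mathbb{Z}_2$ if $p=2$, be any map. The associated generalized right-angled Artin pro-$p$ group is the pro-$p$ group with pro-$p$ presentation $$G_{\Gamma,f}=\langle v\in V\mid [v,w]=v^{\lambda_1}w^{\lambda_2}\ \text{for } (v,w)\in E,\ (\lambda_1,\lambda_2)=f(v,w)\rangle.$$ For $f=0$ it is the right-angled Artin pro-$p$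 group $G_\Gamma$. $\Delta$-right-angled Artin pro-$2$ groups: let $\Gamma=(V,E)$ be a finite graph with right-angled Artin pro-$2$ group $G_\Gamma$ (generated by $V$ with relations $[v,w]=1$ for adjacent $v,w$), and let $\Delta=\{1,x_0\}$ be the group of order two. Let $\mathbf{z}:V\to G_\Gamma$, $v\mapsto\mathbf{z}_v$, be a function such that $v\mapsto \mathbf{z}_v v^{ -1}\mathbf{z}_v^{ -1}$ $(v\in V)$ induces an automorphism $a_{\mathbf{z}}$ of $G_\Gamma$ of order two. Let $\Delta$ act on $G_\Gamma$ by $x_0\mapsto a_{\mathbf{z}}$. The associated $\Delta$-right-angled Artin pro-$2$ group is the semidirect product $G_{\Gamma,\mathbf{z}}=G_\Gamma\rtimes\Delta$. -}

module Defs where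

open import Algebra.Bundles using (Group; CommutativeRing)
open import Algebra.Morphism.Structures
  using (module GroupMorphisms)
import Algebra.Morphism.GroupMonomorphism as GroupMonomorphism
import Algebra.Definitions.RawMonoid as RawMonoid
import Algebra.Properties.Group as GroupProperties
import Algebra.Properties.Semiring.Sum as SemiringSummation
import Algebra.Properties.CommutativeMonoid.Sum as Summation
open import Data.Bool.Base using (Bool; true; false; T; _xor_)
import Data.Bool.Properties as Bool
open import Data.Fin.Base using (Fin)
import Data.Fin.Properties as Fin
open import Data.Fin.Permutation using (Permutation; permutation)
open import Data.Integer.Base as ℤ using (ℤ; +_; 0ℤ; 1ℤ)
import Data.Integer.Properties as ℤ
open import Data.Integer.Divisibility.Signed as ℤ using ()
open import Data.Integer.Tactic.RingSolver using ()
  renaming (solve-∀ to solve-∀-ℤ)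
open import Data.List.Base as List using (List; []; _∷_)
open import Data.List.Membership.Propositional.Properties using (∈-lookup)
open import Data.List.Relation.Unary.All as All using (All)
open import Data.List.Relation.Unary.AllPairs using (AllPairs; []; _∷_)
open import Data.List.Relation.Unary.Any as Any using (Any; here; there)
import Data.List.Relation.Unary.Any.Properties as Any
import Data.List.Relation.Unary.Unique.DecSetoid.Properties as Unique
import Data.List.Membership.Setoid.Properties as Membership
open import Data.Maybe.Base using (nothing)
open import Data.Nat.Base as ℕ using (ℕ; zero; suc; ∣_-_∣)
import Data.Nat.Properties as ℕ
open import Data.Nat.Divisibility using (_∣_; _∣0)
open import Data.Product.Base using (Σ; ∃; _×_; _,_; proj₁; proj₂)
open import Data.Vec.Base using (Vec; []; _∷_)
open import Data.Vec.Relation.Binary.Pointwise.Inductive as Pointwise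
  using (Pointwise; []; _∷_)
open import Function.Base using (_∘_; _on_)
open import Function.Bundles using (Func)
open import Function.Definitions using (Surjective)
open import Level using (0ℓ)
open import Relation.Binary.Bundles using (Setoid; DecSetoid)
import Relation.Binary.Construct.On as On
open import Relation.Binary.Definitions using (_Respects_)
open import Relation.Binary.PropositionalEquality as ≡ using (_≡_)
import Relation.Binary.Reasoning.Setoid as ≈-Reasoning
open import Relation.Nullary using (¬_; Dec; yes; no; contradiction)
import Relation.Nullary.Decidable as Dec
open import Relation.Unary using (Pred; _⊆_)
import Tactic.RingSolver.NonReflective as NonReflective
import Tactic.RingSolver.Core.AlmostCommutativeRing as ACR

module _ (G : Group 0ℓ 0ℓ) where
  open Group G

  record IsSubgroup (U : Pred Carrier 0ℓ) : Set where
    field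
      respects  : U Respects _≈_
      ε-closed  : U ε
      ∙-closed  : ∀ {g h} → U g → U h → U (g ∙ h)
      ⁻¹-closed : ∀ {g} → U g → U (g ⁻¹)

  record IsNormalSubgroup (U : Pred Carrier 0ℓ) : Set where
    field
      isSubgroup  : IsSubgroup U
      conj-closed : ∀ g {u} → U u → U (g ∙ u ∙ g ⁻¹)
    open IsSubgroup isSubgroup public

  -- Equality of the right cosets U g and U h.
  SameCoset : Pred Carrier 0ℓ → Carrier → Carrier → Set
  SameCoset U g h = U (g // h)

  -- The index of U in G is n, witnessed by a right transversal of U.
  record HasIndex (U : Pred Carrier 0ℓ) (n : ℕ) : Set where
    field
      rep           : Fin n → Carrier
      coset         : Carrier → Fin n
      rep-coset     : ∀ g → SameCoset U g (rep (coset g))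
      rep-injective : ∀ {s t} → SameCoset U (rep s) (rep t) → s ≡ t

module SubgroupProperties (G : Group 0ℓ 0ℓ) where
  open Group G
  open GroupProperties G
  open ≈-Reasoning setoid

  telescope : ∀ r r′ r″ g h →
              r ∙ (g ∙ h) // r″ ≈ (r ∙ g // r′) ∙ (r′ ∙ h // r″)
  telescope r r′ r″ g h = begin
    r ∙ (g ∙ h) // r″               ≈⟨ ∙-congʳ (assoc r g h) ⟨
    r ∙ g ∙ h // r″                 ≈⟨ ∙-congʳ (∙-congʳ (//-rightDividesˡ r′ (r ∙ g))) ⟨
    (r ∙ g // r′) ∙ r′ ∙ h // r″    ≈⟨ ∙-congʳ (assoc _ _ _) ⟩
    (r ∙ g // r′) ∙ (r′ ∙ h) // r″  ≈⟨ assoc _ _ _ ⟩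
    (r ∙ g // r′) ∙ (r′ ∙ h // r″)  ∎

  module Cosets {U : Pred Carrier 0ℓ} (U-sub : IsSubgroup G U) where
    open IsSubgroup U-sub

    infix 4 _∼_
    _∼_ : Carrier → Carrier → Set
    _∼_ = SameCoset G U

    ≈⇒∼ : ∀ {g h} → g ≈ h → g ∼ h
    ≈⇒∼ g≈h = respects (sym (x≈y⇒x∙y⁻¹≈ε g≈h)) ε-closed

    ∼-refl : ∀ {g} → g ∼ g
    ∼-refl = ≈⇒∼ refl

    ∼-sym : ∀ {g h} → g ∼ h → h ∼ g
    ∼-sym g∼h = respects (⁻¹-anti-homo-// _ _) (⁻¹-closed g∼h)

    ∼-trans : ∀ {g h k} → g ∼ h → h ∼ k → g ∼ k
    ∼-trans {g} {h} {k} g∼h h∼k = respects eq (∙-closed g∼h h∼k)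
      where
      eq : (g // h) ∙ (h // k) ≈ g // k
      eq = begin
        (g // h) ∙ (h // k)  ≈⟨ assoc _ _ _ ⟨
        (g // h) ∙ h // k    ≈⟨ ∙-congʳ (//-rightDividesˡ h g) ⟩
        g // k               ∎

    ∼-congʳ : ∀ {g h} k → g ∼ h → g ∙ k ∼ h ∙ k
    ∼-congʳ {g} {h} k g∼h = respects eq g∼h
      where
      eq : g // h ≈ (g ∙ k) // (h ∙ k)
      eq = begin
        g // h                     ≈⟨ ∙-congʳ (//-rightDividesʳ k g) ⟨
        ((g ∙ k) // k) // h        ≈⟨ assoc _ _ _ ⟩
        (g ∙ k) ∙ (k ⁻¹ ∙ h ⁻¹)    ≈⟨ ∙-congˡ (⁻¹-anti-homo-∙ h k) ⟨
        (g ∙ k) // (h ∙ k)         ∎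

    ε∼⇒∈ : ∀ {g} → g ∼ ε → U g
    ε∼⇒∈ {g} = respects (trans (∙-congˡ ε⁻¹≈ε) (identityʳ g))

    ∈⇒ε∼ : ∀ {g} → U g → g ∼ ε
    ∈⇒ε∼ {g} = respects (sym (trans (∙-congˡ ε⁻¹≈ε) (identityʳ g)))

    ∼-closed : ∀ {g h} → g ∼ h → U g → U h
    ∼-closed g∼h u = ε∼⇒∈ (∼-trans (∼-sym g∼h) (∈⇒ε∼ u))

    cosets : Setoid 0ℓ 0ℓ
    cosets = record
      { Carrier       = Carrier
      ; _≈_           = _∼_
      ; isEquivalence = record
        { refl = ∼-refl ; sym = ∼-sym ; trans = ∼-trans }
      }

    coset-cong : ∀ {n} (ix : HasIndex G U n) {g h} → g ∼ h →
                 HasIndex.coset ix g ≡ HasIndex.coset ix h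
    coset-cong ix g∼h = rep-injective
      (∼-trans (∼-sym (rep-coset _)) (∼-trans g∼h (rep-coset _)))
      where open HasIndex ix

    ∈? : ∀ {n} → HasIndex G U n → ∀ g → Dec (U g)
    ∈? ix g = Dec.map′
      (λ eq → ε∼⇒∈ (∼-trans (rep-coset g)
        (≡.subst (λ c → rep c ∼ ε) (≡.sym eq) (∼-sym (rep-coset ε)))))
      (coset-cong ix ∘ ∈⇒ε∼)
      (coset g Fin.≟ coset ε)
      where open HasIndex ix

    representatives : ∀ {n} → HasIndex G U n →
                      ∃ λ xs → ∀ g → Any (g ∼_) xs
    representatives ix =
      List.tabulate rep , λ g → Any.tabulate⁺ (coset g) (rep-coset g)
      where open HasIndex ix

    finiteIndex : (∀ g → Dec (U g)) → ∀ xs → (∀ g → Any (g ∼_) xs) →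
                  ∃ (HasIndex G U)
    finiteIndex U? xs covers = List.length ys , record
      { rep           = List.lookup ys
      ; coset         = λ g → Any.index (covers′ g)
      ; rep-coset     = λ g → Any.lookup-index (covers′ g)
      ; rep-injective = injective (Unique.deduplicate-! decCosets xs) _ _
      }
      where
      decCosets : DecSetoid 0ℓ 0ℓ
      decCosets = record
        { isDecEquivalence = record
          { isEquivalence = Setoid.isEquivalence cosets
          ; _≟_           = λ g h → U? (g // h)
          }
        }

      ys : List Carrier
      ys = List.deduplicate (DecSetoid._≟_ decCosets) xs

      covers′ : ∀ g → Any (g ∼_) ys
      covers′ g = Membership.∈-deduplicate⁺ cosets (DecSetoid._≟_ decCosets)
        (λ y∼z x∼z → ∼-trans x∼z (∼-sym y∼z)) (covers g)

      injective : ∀ {zs} → AllPairs (λ g h → ¬ g ∼ h) zs → ∀ s t →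
                  List.lookup zs s ∼ List.lookup zs t → s ≡ t
      injective (x ∷ _)  Fin.zero    Fin.zero    _ = ≡.refl
      injective (x ∷ _)  Fin.zero    (Fin.suc t) e =
        contradiction e (All.lookup x (∈-lookup t))
      injective (x ∷ _)  (Fin.suc s) Fin.zero    e =
        contradiction (∼-sym e) (All.lookup x (∈-lookup s))
      injective (_ ∷ xs) (Fin.suc s) (Fin.suc t) e =
        ≡.cong Fin.suc (injective xs s t e)

  module NormalCosets {U : Pred Carrier 0ℓ} (U-normal : IsNormalSubgroup G U) where
    open IsNormalSubgroup U-normal
    open Cosets isSubgroup public

    ∼-congˡ : ∀ k {g h} → g ∼ h → k ∙ g ∼ k ∙ h
    ∼-congˡ k {g} {h} g∼h = respects eq (conj-closed k g∼h)
      where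
      eq : k ∙ (g // h) ∙ k ⁻¹ ≈ (k ∙ g) // (k ∙ h)
      eq = begin
        k ∙ (g // h) ∙ k ⁻¹      ≈⟨ ∙-congʳ (assoc k g (h ⁻¹)) ⟨
        k ∙ g ∙ h ⁻¹ ∙ k ⁻¹      ≈⟨ assoc _ _ _ ⟩
        k ∙ g ∙ (h ⁻¹ ∙ k ⁻¹)    ≈⟨ ∙-congˡ (⁻¹-anti-homo-∙ k h) ⟨
        (k ∙ g) // (k ∙ h)       ∎

    ∼-∙-cong : ∀ {g g′ h h′} → g ∼ g′ → h ∼ h′ → g ∙ h ∼ g′ ∙ h′
    ∼-∙-cong g∼g′ h∼h′ = ∼-trans (∼-congʳ _ g∼g′) (∼-congˡ _ h∼h′)

-- A profinite group is presented by a base (N i) of neighbourhoods of ε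
-- consisting of normal subgroups of finite index: it is Hausdorff and
-- complete, i.e. the canonical map to the inverse limit of the finite
-- groups G / N i is bijective.  An element of that limit is given by a
-- choice of representatives x i, compatible modulo the N i.
-- The transversals in N-finite also make membership in N i decidable.
record ProfiniteGroup : Set₁ where
  field
    group : Group 0ℓ 0ℓ
  open Group group public
  field
    Ix        : Set
    N         : Ix → Pred Carrier 0ℓ
    N-normal  : ∀ i → IsNormalSubgroup group (N i)
    N-finite  : ∀ i → ∃ (HasIndex group (N i))
    inhabited : Ix
    directed  : ∀ i j → ∃ λ k → N k ⊆ N i × N k ⊆ N j
    separated : ∀ {g} → (∀ i → N i g) → g ≈ ε
    complete  : (x : Ix → Carrier) →
                (∀ {i j} → N j ⊆ N i → SameCoset group (N i) (x j) (x i)) →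
                ∃ λ g → ∀ i → SameCoset group (N i) g (x i)

  module Mod i = SubgroupProperties.NormalCosets group (N-normal i)

  infix 4 _≈_mod_
  _≈_mod_ : Carrier → Carrier → Ix → Set
  g ≈ h mod i = SameCoset group (N i) g h

IsPro : ℕ → ProfiniteGroup → Set
IsPro p G = ∀ i → ∃ λ n → HasIndex group (N i) (p ℕ.^ n)
  where open ProfiniteGroup G

record ContinuousHomomorphism (G H : ProfiniteGroup) : Set where
  private
    module G = ProfiniteGroup G
    module H = ProfiniteGroup H
  open GroupMorphisms G.rawGroup H.rawGroup
  field
    ⟦_⟧                 : G.Carrier → H.Carrier
    isGroupHomomorphism : IsGroupHomomorphism ⟦_⟧
    continuous          : ∀ j → ∃ λ i → ∀ {g} → G.N i g → H.N j ⟦ g ⟧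
  open IsGroupHomomorphism isGroupHomomorphism public

record _≅_ (G H : ProfiniteGroup) : Set where
  private
    module G = ProfiniteGroup G
    module H = ProfiniteGroup H
  open ContinuousHomomorphism
  field
    to       : ContinuousHomomorphism G H
    from     : ContinuousHomomorphism H G
    to∘from  : ∀ h → ⟦ to ⟧ (⟦ from ⟧ h) H.≈ h
    from∘to  : ∀ g → ⟦ from ⟧ (⟦ to ⟧ g) G.≈ g

record OpenSubgroup (G : ProfiniteGroup) (n : ℕ) : Set₁ where
  open ProfiniteGroup G
  field
    U          : Pred Carrier 0ℓ
    isSubgroup : IsSubgroup group U
    isOpen     : ∃ λ i → N i ⊆ U
    hasIndex   : HasIndex group U n

IsNormal : ∀ {G n} → OpenSubgroup G n → Set
IsNormal {G} S = IsNormalSubgroup (ProfiniteGroup.group G) (OpenSubgroup.U S)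

-- The profinite group U, with base (N i ∩ U).
module _ {G : ProfiniteGroup} {n : ℕ} (S : OpenSubgroup G n) where
  open ProfiniteGroup G
  open OpenSubgroup S
  open IsSubgroup isSubgroup
  private
    module U∼ = SubgroupProperties.Cosets group isSubgroup

    subgroup : Group 0ℓ 0ℓ
    subgroup = record
      { Carrier = Σ Carrier U
      ; _≈_     = _≈_ on proj₁
      ; _∙_     = λ (g , u) (h , v) → g ∙ h , ∙-closed u v
      ; ε       = ε , ε-closed
      ; _⁻¹     = λ (g , u) → g ⁻¹ , ⁻¹-closed u
      ; isGroup = GroupMonomorphism.isGroup inclusion isGroup
      }
      where
      inclusion : GroupMorphisms.IsGroupMonomorphism _ rawGroup proj₁
      inclusion = record
        { isGroupHomomorphism = record
          { isMonoidHomomorphism = record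
            { isMagmaHomomorphism = record
              { isRelHomomorphism = record { cong = λ eq → eq }
              ; homo              = λ _ _ → refl
              }
            ; ε-homo = refl
            }
          ; ⁻¹-homo = λ _ → refl
          }
        ; injective = λ eq → eq
        }

    N∩U : Ix → Pred (Σ Carrier U) 0ℓ
    N∩U i (g , _) = N i g

    N∩U-normal : ∀ i → IsNormalSubgroup subgroup (N∩U i)
    N∩U-normal i = record
      { isSubgroup = record
        { respects  = N.respects
        ; ε-closed  = N.ε-closed
        ; ∙-closed  = N.∙-closed
        ; ⁻¹-closed = N.⁻¹-closed
        }
      ; conj-closed = λ (g , _) → N.conj-closed g
      }
      where module N = IsNormalSubgroup (N-normal i)

    N∩U-finite : ∀ i → ∃ (HasIndex subgroup (N∩U i))
    N∩U-finite i = Cosets.finiteIndex (IsNormalSubgroup.isSubgroup (N∩U-normal i))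
      (λ (g , _) → Mod.∈? i (proj₂ (N-finite i)) g)
      (restrict xs)
      (λ (g , u) → restrict-covers u xs (covers g))
      where
      open SubgroupProperties subgroup
      k : Ix
      k = proj₁ (directed i (proj₁ isOpen))

      k⊆i : N k ⊆ N i
      k⊆i = proj₁ (proj₂ (directed i (proj₁ isOpen)))

      k⊆U : N k ⊆ U
      k⊆U = proj₂ isOpen ∘ proj₂ (proj₂ (directed i (proj₁ isOpen)))

      xs : List Carrier
      xs = proj₁ (Mod.representatives k (proj₂ (N-finite k)))

      covers : ∀ g → Any (λ x → g ≈ x mod k) xs
      covers = proj₂ (Mod.representatives k (proj₂ (N-finite k)))

      restrict : List Carrier → List (Σ Carrier U)
      restrict []       = []
      restrict (y ∷ ys) with U∼.∈? hasIndex y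
      ... | yes u = (y , u) ∷ restrict ys
      ... | no  _ = restrict ys

      restrict-covers : ∀ {g} (u : U g) ys → Any (λ x → g ≈ x mod k) ys →
                        Any (SameCoset subgroup (N∩U i) (g , u)) (restrict ys)
      restrict-covers u (y ∷ ys) p with U∼.∈? hasIndex y | p
      ... | yes _ | here g∼y = here (k⊆i g∼y)
      ... | yes _ | there q  = there (restrict-covers u ys q)
      ... | no ¬u | here g∼y = contradiction (U∼.∼-closed (k⊆U g∼y) u) ¬u
      ... | no _  | there q  = restrict-covers u ys q

  asProfiniteGroup : ProfiniteGroup
  asProfiniteGroup = record
    { group     = subgroup
    ; Ix        = Ix
    ; N         = N∩U
    ; N-normal  = N∩U-normal
    ; N-finite  = N∩U-finite
    ; inhabited = inhabited
    ; directed  = λ i j → let k , k⊆i , k⊆j = directed i j in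
                  k , (λ {g} → k⊆i {proj₁ g}) , (λ {g} → k⊆j {proj₁ g})
    ; separated = separated
    ; complete  = λ x compatible →
        let
          i , i⊆U = isOpen
          g , lim = complete (proj₁ ∘ x)
                      (λ j⊆i → compatible (λ {u} → j⊆i {proj₁ u}))
        in (g , U∼.∼-closed (U∼.∼-sym (i⊆U (lim i))) (proj₂ (x i))) , lim
    }

module _ (p : ℕ) where
  infix 4 _≡ₚ_
  record _≡ₚ_ (a b : ℤ) : Set where
    constructor congruent
    field divides : + p ℤ.∣ a ℤ.- b

  private
    from-≡ : ∀ {a b} → a ≡ b → a ≡ₚ b
    from-≡ {a} ≡.refl = congruent (ℤ.divides 0ℤ (ℤ.+-inverseʳ a))

    sym′ : ∀ {a b} → a ≡ₚ b → b ≡ₚ a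
    sym′ {a} {b} (congruent e) =
      congruent (≡.subst (+ p ℤ.∣_) (lemma a b) (ℤ.∣m⇒∣-m e))
      where
      lemma : ∀ a b → ℤ.- (a ℤ.- b) ≡ b ℤ.- a
      lemma = solve-∀-ℤ

    trans′ : ∀ {a b c} → a ≡ₚ b → b ≡ₚ c → a ≡ₚ c
    trans′ {a} {b} {c} (congruent e) (congruent e′) =
      congruent (≡.subst (+ p ℤ.∣_) (lemma a b c) (ℤ.∣m∣n⇒∣m+n e e′))
      where
      lemma : ∀ a b c → (a ℤ.- b) ℤ.+ (b ℤ.- c) ≡ a ℤ.- c
      lemma = solve-∀-ℤ

    +-cong′ : ∀ {a b c d} → a ≡ₚ b → c ≡ₚ d → a ℤ.+ c ≡ₚ b ℤ.+ d
    +-cong′ {a} {b} {c} {d} (congruent e) (congruent e′) =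
      congruent (≡.subst (+ p ℤ.∣_) (lemma a b c d) (ℤ.∣m∣n⇒∣m+n e e′))
      where
      lemma : ∀ a b c d → (a ℤ.- b) ℤ.+ (c ℤ.- d) ≡ (a ℤ.+ c) ℤ.- (b ℤ.+ d)
      lemma = solve-∀-ℤ

    *-cong′ : ∀ {a b c d} → a ≡ₚ b → c ≡ₚ d → a ℤ.* c ≡ₚ b ℤ.* d
    *-cong′ {a} {b} {c} {d} (congruent e) (congruent e′) =
      congruent (≡.subst (+ p ℤ.∣_) (lemma a b c d)
        (ℤ.∣m∣n⇒∣m+n (ℤ.∣m⇒∣m*n c e) (ℤ.∣n⇒∣m*n b e′)))
      where
      lemma : ∀ a b c d →
              (a ℤ.- b) ℤ.* c ℤ.+ b ℤ.* (c ℤ.- d) ≡ a ℤ.* c ℤ.- b ℤ.* d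
      lemma = solve-∀-ℤ

    neg-cong : ∀ {a b} → a ≡ₚ b → ℤ.- a ≡ₚ ℤ.- b
    neg-cong {a} {b} (congruent e) =
      congruent (≡.subst (+ p ℤ.∣_) (lemma a b) (ℤ.∣m⇒∣-m e))
      where
      lemma : ∀ a b → ℤ.- (a ℤ.- b) ≡ ℤ.- a ℤ.- (ℤ.- b)
      lemma = solve-∀-ℤ

  𝔽 : CommutativeRing 0ℓ 0ℓ
  𝔽 = record
    { Carrier = ℤ
    ; _≈_     = _≡ₚ_
    ; _+_     = ℤ._+_
    ; _*_     = ℤ._*_
    ; -_      = ℤ.-_
    ; 0#      = 0ℤ
    ; 1#      = 1ℤ
    ; isCommutativeRing = record
      { isRing = record
        { +-isAbelianGroup = record
          { isGroup = record
            { isMonoid = record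
              { isSemigroup = record
                { isMagma = record
                  { isEquivalence = record
                    { refl  = from-≡ ≡.refl
                    ; sym   = sym′
                    ; trans = trans′
                    }
                  ; ∙-cong = +-cong′
                  }
                ; assoc = λ a b c → from-≡ (ℤ.+-assoc a b c)
                }
              ; identity = (λ a → from-≡ (ℤ.+-identityˡ a))
                         , (λ a → from-≡ (ℤ.+-identityʳ a))
              }
            ; inverse = (λ a → from-≡ (ℤ.+-inverseˡ a))
                      , (λ a → from-≡ (ℤ.+-inverseʳ a))
            ; ⁻¹-cong = neg-cong
            }
          ; comm = λ a b → from-≡ (ℤ.+-comm a b)
          }
        ; *-cong     = *-cong′
        ; *-assoc    = λ a b c → from-≡ (ℤ.*-assoc a b c)
        ; *-identity = (λ a → from-≡ (ℤ.*-identityˡ a))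
                     , (λ a → from-≡ (ℤ.*-identityʳ a))
        ; distrib    = (λ a b c → from-≡ (ℤ.*-distribˡ-+ a b c))
                     , (λ a b c → from-≡ (ℤ.*-distribʳ-+ a b c))
        }
      ; *-comm = λ a b → from-≡ (ℤ.*-comm a b)
      }
    }

-- Continuous cohomology with coefficients in the discrete ring K, on which
-- the group acts trivially.
module Cohomology (K : CommutativeRing 0ℓ 0ℓ) where
  open CommutativeRing K hiding (zero)
  open GroupProperties +-group
    using (⁻¹-anti-homo-//; ε⁻¹≈ε; x∙y⁻¹≈ε⇒x≈y; x≈y⇒x∙y⁻¹≈ε; //-rightDividesˡ; //-rightDividesʳ)
  open Summation +-commutativeMonoid
    using (sum; sum-cong-≋; sum-permute; ∑-distrib-+)
  open SemiringSummation semiring using (*-distribʳ-sum)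
  open ≈-Reasoning setoid
  private
    almostCommutativeRing : ACR.AlmostCommutativeRing 0ℓ 0ℓ
    almostCommutativeRing = ACR.fromCommutativeRing K λ _ → nothing

    open NonReflective almostCommutativeRing
      using (solve; _⊜_; _⊕_; _⊗_; ⊝_)

    a-c≈[a-b]-[c-b] : ∀ a b c → a - c ≈ (a - b) - (c - b)
    a-c≈[a-b]-[c-b] a b c = begin
      a - c              ≈⟨ +-congʳ (//-rightDividesˡ b a) ⟨
      (a - b) + b - c    ≈⟨ +-assoc _ _ _ ⟩
      (a - b) + (b - c)  ≈⟨ +-congˡ (⁻¹-anti-homo-// c b) ⟨
      (a - b) - (c - b)  ∎

    [a-a′]-[b-b′] : ∀ a a′ b b′ → (a - a′) - (b - b′) ≈ (a - b) - (a′ - b′)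
    [a-a′]-[b-b′] = solve 4 (λ a a′ b b′ →
      ((a ⊕ ⊝ a′) ⊕ ⊝ (b ⊕ ⊝ b′)) ⊜ ((a ⊕ ⊝ b) ⊕ ⊝ (a′ ⊕ ⊝ b′))) refl

    move : ∀ {x a b c} → x + b ≈ a + c → x ≈ a - (b - c)
    move {x} {a} {b} {c} e = begin
      x            ≈⟨ //-rightDividesʳ b x ⟨
      x + b - b    ≈⟨ +-congʳ e ⟩
      a + c - b    ≈⟨ +-assoc _ _ _ ⟩
      a + (c - b)  ≈⟨ +-congˡ (⁻¹-anti-homo-// b c) ⟨
      a - (b - c)  ∎

    unmove : ∀ {x a b c} → x ≈ a - (b - c) → x + b ≈ a + c
    unmove {x} {a} {b} {c} e = begin
      x + b              ≈⟨ +-congʳ e ⟩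
      a - (b - c) + b    ≈⟨ +-congʳ (+-congˡ (⁻¹-anti-homo-// b c)) ⟩
      a + (c - b) + b    ≈⟨ +-assoc _ _ _ ⟩
      a + (c - b + b)    ≈⟨ +-congˡ (//-rightDividesˡ b c) ⟩
      a + c              ∎

    exchange : ∀ {x a b c} → x + b ≈ a + c → x - a ≈ c - b
    exchange {x} {a} {b} {c} e = begin
      x - a            ≈⟨ +-congʳ (//-rightDividesʳ b x) ⟨
      x + b - b - a    ≈⟨ +-congʳ (+-congʳ e) ⟩
      a + c - b - a    ≈⟨ solve 3 (λ a c d → (a ⊕ c ⊕ d ⊕ ⊝ a) ⊜ (c ⊕ d ⊕ a ⊕ ⊝ a))
                            refl a c (- b) ⟩
      c - b + a - a    ≈⟨ //-rightDividesʳ a (c - b) ⟩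
      c - b            ∎

  module _ (G : ProfiniteGroup) where
    private module G = ProfiniteGroup G

    -- Inhomogeneous cochains.  As G is compact, a map from Gⁿ to a
    -- discrete set is continuous if and only if it factors through
    -- (G / N i)ⁿ for some i.
    record Cochain (n : ℕ) : Set where
      field
        ⟦_⟧        : Vec G.Carrier n → Carrier
        continuous : ∃ λ i → ∀ {xs ys} →
                     Pointwise (λ x y → x G.≈ y mod i) xs ys →
                     ⟦ xs ⟧ ≈ ⟦ ys ⟧
    open Cochain

    -- (δ f)(g₀,…,gₙ) = f(g₁,…,gₙ) - δ′ f g₀ (g₁,…,gₙ), where
    --   δ′ f g₀ (g₁,…,gₙ) = Σ_{1≤i≤n} (-1)ⁱ⁻¹ f(…,gᵢ₋₁gᵢ,…) + (-1)ⁿ f(g₀,…,gₙ₋₁).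
    δ′ : ∀ {n} → (Vec G.Carrier n → Carrier) →
         G.Carrier → Vec G.Carrier n → Carrier
    δ′ f g []       = f []
    δ′ f g (h ∷ hs) = f (g G.∙ h ∷ hs) - δ′ (λ xs → f (g ∷ xs)) h hs

    δ : ∀ {n} → (Vec G.Carrier n → Carrier) → Vec G.Carrier (suc n) → Carrier
    δ f (g ∷ gs) = f gs - δ′ f g gs

    record Cocycle (n : ℕ) : Set where
      field
        cochain : Cochain n
        closed  : ∀ gs → δ ⟦ cochain ⟧ gs ≈ 0#
      open Cochain cochain public

    IsCoboundary : ∀ {n} → (Vec G.Carrier n → Carrier) → Set
    IsCoboundary {zero}  f = ∀ gs → f gs ≈ 0#
    IsCoboundary {suc n} f =
      Σ (Cochain n) λ φ → ∀ gs → f gs ≈ δ ⟦ φ ⟧ gs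

    δ′-sub : ∀ {n} (f f′ : Vec G.Carrier n → Carrier) g gs →
             δ′ (λ xs → f xs - f′ xs) g gs ≈ δ′ f g gs - δ′ f′ g gs
    δ′-sub f f′ g []       = refl
    δ′-sub f f′ g (h ∷ hs) = begin
      (a - a′) - δ′ (λ xs → f (g ∷ xs) - f′ (g ∷ xs)) h hs
        ≈⟨ +-congˡ (-‿cong (δ′-sub (f ∘ (g ∷_)) (f′ ∘ (g ∷_)) h hs)) ⟩
      (a - a′) - (b - b′)
        ≈⟨ [a-a′]-[b-b′] a a′ b b′ ⟩
      (a - b) - (a′ - b′)  ∎
      where
      a  = f (g G.∙ h ∷ hs)
      a′ = f′ (g G.∙ h ∷ hs)
      b  = δ′ (f ∘ (g ∷_)) h hs
      b′ = δ′ (f′ ∘ (g ∷_)) h hs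

    δ-sub : ∀ {n} (f f′ : Vec G.Carrier n → Carrier) gs →
            δ (λ xs → f xs - f′ xs) gs ≈ δ f gs - δ f′ gs
    δ-sub f f′ (g ∷ gs) = begin
      (f gs - f′ gs) - δ′ (λ xs → f xs - f′ xs) g gs
        ≈⟨ +-congˡ (-‿cong (δ′-sub f f′ g gs)) ⟩
      (f gs - f′ gs) - (δ′ f g gs - δ′ f′ g gs)
        ≈⟨ [a-a′]-[b-b′] (f gs) (f′ gs) (δ′ f g gs) (δ′ f′ g gs) ⟩
      δ f (g ∷ gs) - δ f′ (g ∷ gs)  ∎

    0-cochain : ∀ {n} → Cochain n
    0-cochain = record
      { ⟦_⟧ = λ _ → 0# ; continuous = G.inhabited , λ _ → refl }

    δ′-zero : ∀ {n} g (gs : Vec G.Carrier n) → δ′ (λ _ → 0#) g gs ≈ 0#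
    δ′-zero g []       = refl
    δ′-zero g (h ∷ hs) = trans (+-congˡ (-‿cong (δ′-zero h hs))) (-‿inverseʳ 0#)

    δ-zero : ∀ {n} (gs : Vec G.Carrier (suc n)) → δ (λ _ → 0#) gs ≈ 0#
    δ-zero (g ∷ gs) = trans (+-congˡ (-‿cong (δ′-zero g gs))) (-‿inverseʳ 0#)

    _-ᶜ_ : ∀ {n} → Cochain n → Cochain n → Cochain n
    φ -ᶜ ψ = record
      { ⟦_⟧        = λ xs → ⟦ φ ⟧ xs - ⟦ ψ ⟧ xs
      ; continuous =
        let
          i , φ-const = continuous φ
          j , ψ-const = continuous ψ
          k , k⊆i , k⊆j = G.directed i j
        in k , λ e → +-cong (φ-const (Pointwise.map k⊆i e))
                       (-‿cong (ψ-const (Pointwise.map k⊆j e)))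
      }

    coboundary-zero : ∀ {n} {f : Vec G.Carrier n → Carrier} →
                      (∀ gs → f gs ≈ 0#) → IsCoboundary f
    coboundary-zero {zero}  f≈0 = f≈0
    coboundary-zero {suc n} f≈0 =
      0-cochain , λ gs → trans (f≈0 gs) (sym (δ-zero gs))

    coboundary-sub : ∀ {n} {f f′ h : Vec G.Carrier n → Carrier} →
                     IsCoboundary f → IsCoboundary f′ →
                     (∀ gs → h gs ≈ f gs - f′ gs) → IsCoboundary h
    coboundary-sub {zero} f≈0 f′≈0 eq gs = begin
      _        ≈⟨ eq gs ⟩
      _        ≈⟨ +-cong (f≈0 gs) (-‿cong (f′≈0 gs)) ⟩
      0# - 0#  ≈⟨ -‿inverseʳ 0# ⟩
      0#       ∎
    coboundary-sub {suc n} (φ , f≈δφ) (ψ , f′≈δψ) eq = φ -ᶜ ψ , λ gs → begin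
      _                        ≈⟨ eq gs ⟩
      _                        ≈⟨ +-cong (f≈δφ gs) (-‿cong (f′≈δψ gs)) ⟩
      δ ⟦ φ ⟧ gs - δ ⟦ ψ ⟧ gs  ≈⟨ δ-sub ⟦ φ ⟧ ⟦ ψ ⟧ gs ⟨
      δ ⟦ φ -ᶜ ψ ⟧ gs          ∎

    infix 4 _∼ᶜ_
    record _∼ᶜ_ {n} (a b : Cocycle n) : Set where
      constructor cohomologous
      field
        difference : IsCoboundary (λ gs → Cocycle.⟦_⟧ a gs - Cocycle.⟦_⟧ b gs)

    H : ℕ → Setoid 0ℓ 0ℓ
    H n = record
      { Carrier       = Cocycle n
      ; _≈_           = _∼ᶜ_
      ; isEquivalence = record
        { refl  = λ {a} → refl′ a
        ; sym   = λ {a} {b} → sym′ a b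
        ; trans = λ {a} {b} {c} → trans′ a b c
        }
      }
      where
      open Cocycle using () renaming (⟦_⟧ to ⟪_⟫)

      refl′ : ∀ a → a ∼ᶜ a
      refl′ a = cohomologous (coboundary-zero λ gs → -‿inverseʳ (⟪ a ⟫ gs))

      sym′ : ∀ a b → a ∼ᶜ b → b ∼ᶜ a
      sym′ a b (cohomologous e) = cohomologous
        (coboundary-sub (coboundary-zero (λ _ → refl)) e λ gs →
          sym (trans (+-identityˡ _) (⁻¹-anti-homo-// (⟪ a ⟫ gs) (⟪ b ⟫ gs))))

      trans′ : ∀ a b c → a ∼ᶜ b → b ∼ᶜ c → a ∼ᶜ c
      trans′ a b c (cohomologous e) b∼c = cohomologous
        (coboundary-sub e (_∼ᶜ_.difference (sym′ b c b∼c)) λ gs →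
          a-c≈[a-b]-[c-b] (⟪ a ⟫ gs) (⟪ b ⟫ gs) (⟪ c ⟫ gs))

    0ᴴ : ∀ {n} → Cocycle n
    0ᴴ = record { cochain = 0-cochain ; closed = δ-zero }

    Additive : (G.Carrier → Carrier) → Set
    Additive a = ∀ g h → a (g G.∙ h) ≈ a g + a h

    LocallyConstant : (G.Carrier → Carrier) → Set
    LocallyConstant a = ∃ λ i → ∀ {g h} → g G.≈ h mod i → a g ≈ a h

    cochain¹ : ∀ a → LocallyConstant a → Cochain 1
    cochain¹ a (i , const) = record
      { ⟦_⟧        = λ { (g ∷ []) → a g }
      ; continuous = i , λ { (e ∷ []) → const e }
      }

    cocycle¹ : ∀ a → LocallyConstant a → Additive a → Cocycle 1
    cocycle¹ a const additive = record
      { cochain = cochain¹ a const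
      ; closed  = λ { (g ∷ h ∷ []) → sym (move (begin
          0# + a (g G.∙ h)  ≈⟨ +-identityˡ _ ⟩
          a (g G.∙ h)       ≈⟨ additive g h ⟩
          a g + a h         ≈⟨ +-comm _ _ ⟩
          a h + a g         ∎)) }
      }

    eval¹ : Cocycle 1 → G.Carrier → Carrier
    eval¹ a g = Cocycle.⟦_⟧ a (g ∷ [])

    additive : ∀ a → Additive (eval¹ a)
    additive a g h = begin
      eval¹ a (g G.∙ h)       ≈⟨ +-identityˡ _ ⟨
      0# + eval¹ a (g G.∙ h)  ≈⟨ unmove (sym (Cocycle.closed a (g ∷ h ∷ []))) ⟩
      eval¹ a h + eval¹ a g   ≈⟨ +-comm _ _ ⟩
      eval¹ a g + eval¹ a h   ∎

    locallyConstant : ∀ a → LocallyConstant (eval¹ a)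
    locallyConstant a =
      let i , const = Cocycle.continuous a in i , λ e → const (e ∷ [])

    ∼ᶜ⇒≈ : ∀ {a b} → a ∼ᶜ b → ∀ g → eval¹ a g ≈ eval¹ b g
    ∼ᶜ⇒≈ (cohomologous (φ , a-b≈δφ)) g =
      x∙y⁻¹≈ε⇒x≈y _ _ (trans (a-b≈δφ (g ∷ [])) (-‿inverseʳ (⟦ φ ⟧ [])))

    ≈⇒∼ᶜ : ∀ {a b} → (∀ g → eval¹ a g ≈ eval¹ b g) → a ∼ᶜ b
    ≈⇒∼ᶜ a≈b = cohomologous (coboundary-zero λ { (g ∷ []) → x≈y⇒x∙y⁻¹≈ε (a≈b g) })

    infixl 7 _⌣_
    _⌣_ : Cocycle 1 → Cocycle 1 → Cocycle 2
    a ⌣ b = record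
      { cochain = record
        { ⟦_⟧        = λ { (g ∷ h ∷ []) → a.⟦ g ∷ [] ⟧ * b.⟦ h ∷ [] ⟧ }
        ; continuous =
          let
            i , a-const = a.continuous
            j , b-const = b.continuous
            k , k⊆i , k⊆j = G.directed i j
          in k , λ { (e ∷ e′ ∷ []) →
            *-cong (a-const (k⊆i e ∷ [])) (b-const (k⊆j e′ ∷ [])) }
        }
      ; closed = λ { (g ∷ h ∷ k ∷ []) → closed g h k }
      }
      where
      module a = Cocycle a
      module b = Cocycle b

      closed : ∀ g h k →
        a.⟦ h ∷ [] ⟧ * b.⟦ k ∷ [] ⟧ -
          (a.⟦ g G.∙ h ∷ [] ⟧ * b.⟦ k ∷ [] ⟧ -
            (a.⟦ g ∷ [] ⟧ * b.⟦ h G.∙ k ∷ [] ⟧ -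
              a.⟦ g ∷ [] ⟧ * b.⟦ h ∷ [] ⟧)) ≈ 0#
      closed g h k = sym (move (begin
        0# + a.⟦ g G.∙ h ∷ [] ⟧ * b₃
          ≈⟨ +-identityˡ _ ⟩
        a.⟦ g G.∙ h ∷ [] ⟧ * b₃
          ≈⟨ *-congʳ (additive a g h) ⟩
        (a₁ + a₂) * b₃
          ≈⟨ distribʳ b₃ a₁ a₂ ⟩
        a₁ * b₃ + a₂ * b₃
          ≈⟨ +-comm _ _ ⟩
        a₂ * b₃ + a₁ * b₃
          ≈⟨ +-congˡ (//-rightDividesʳ (a₁ * b₂) (a₁ * b₃)) ⟨
        a₂ * b₃ + (a₁ * b₃ + a₁ * b₂ - a₁ * b₂)
          ≈⟨ +-congˡ (+-congʳ (trans (*-congˡ (additive b h k))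
               (trans (distribˡ a₁ b₂ b₃) (+-comm _ _)))) ⟨
        a₂ * b₃ + (a₁ * b.⟦ h G.∙ k ∷ [] ⟧ - a₁ * b₂)  ∎))
        where
        a₁ = a.⟦ g ∷ [] ⟧
        a₂ = a.⟦ h ∷ [] ⟧
        b₂ = b.⟦ h ∷ [] ⟧
        b₃ = b.⟦ k ∷ [] ⟧

    𝓡 : Setoid 0ℓ 0ℓ
    𝓡 = record
      { Carrier       = Σ (Cocycle 1) λ α → ∀ β → α ⌣ β ∼ᶜ 0ᴴ
      ; isEquivalence = On.isEquivalence proj₁ (Setoid.isEquivalence (H 1))
      }

  module _ {G : ProfiniteGroup} {n : ℕ} (S : OpenSubgroup G n) where
    private
      module G = ProfiniteGroup G
      open OpenSubgroup S
      open HasIndex hasIndex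
      open SubgroupProperties.Cosets G.group isSubgroup
      open G using (_∙_; _//_)
      module U = ProfiniteGroup (asProfiniteGroup S)

      -- The action of G on the right cosets of U, and the elements of U
      -- defined by rep s ∙ g = step s g ∙ rep (s ▹ g).
      infixl 7 _▹_
      _▹_ : Fin n → G.Carrier → Fin n
      s ▹ g = coset (rep s ∙ g)

      step : Fin n → G.Carrier → U.Carrier
      step s g = rep s ∙ g // rep (s ▹ g) , rep-coset (rep s ∙ g)

      ▹-∙ : ∀ s g h → s ▹ (g ∙ h) ≡ s ▹ g ▹ h
      ▹-∙ s g h = coset-cong hasIndex
        (∼-trans (≈⇒∼ (G.sym (G.assoc _ _ _))) (∼-congʳ h (rep-coset _)))

      ▹-≈ε : ∀ s {g} → g G.≈ G.ε → s ▹ g ≡ s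
      ▹-≈ε s g≈ε = rep-injective (∼-trans (∼-sym (rep-coset _))
        (≈⇒∼ (G.trans (G.∙-congˡ g≈ε) (G.identityʳ _))))

      permute : G.Carrier → Permutation n n
      permute g = permutation (_▹ g) (_▹ (g G.⁻¹))
        (λ s → ≡.trans (≡.sym (▹-∙ s _ _)) (▹-≈ε s (G.inverseˡ g)))
        (λ s → ≡.trans (≡.sym (▹-∙ s _ _)) (▹-≈ε s (G.inverseʳ g)))

      step-∙ : ∀ s g h → step s (g ∙ h) U.≈ step s g U.∙ step (s ▹ g) h
      step-∙ s g h = G.trans
        (G.reflexive (≡.cong (λ t → rep s ∙ (g ∙ h) // rep t) (▹-∙ s g h)))
        (SubgroupProperties.telescope G.group _ _ _ g h)

      sum-step : (U.Carrier → Fin n → Carrier) → G.Carrier → Carrier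
      sum-step Φ g = sum λ s → Φ (step s g) (s ▹ g)

      sum-step-const : ∀ Φ →
        (∃ λ i → ∀ {u v} t → u U.≈ v mod i → Φ u t ≈ Φ v t) →
        LocallyConstant G (sum-step Φ)
      sum-step-const Φ (i , const) = k , λ g∼h → sum-cong-≋ λ s → lemma s g∼h
        where
        k : G.Ix
        k = proj₁ (G.directed i (proj₁ isOpen))

        k⊆i : G.N k ⊆ G.N i
        k⊆i = proj₁ (proj₂ (G.directed i (proj₁ isOpen)))

        k⊆U : G.N k ⊆ U
        k⊆U = proj₂ isOpen ∘ proj₂ (proj₂ (G.directed i (proj₁ isOpen)))

        lemma : ∀ s {g h} → g G.≈ h mod k →
                Φ (step s g) (s ▹ g) ≈ Φ (step s h) (s ▹ h)
        lemma s {g} {h} g∼h = trans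
          (const (s ▹ g) (k⊆i (≡.subst
            (λ t → (rep s ∙ g // rep (s ▹ g)) G.≈ (rep s ∙ h // rep t) mod k) eq
            (G.Mod.∼-congʳ k _ (G.Mod.∼-congˡ k (rep s) g∼h)))))
          (reflexive (≡.cong (Φ (step s h)) eq))
          where
          eq : s ▹ g ≡ s ▹ h
          eq = coset-cong hasIndex (k⊆U (G.Mod.∼-congˡ k (rep s) g∼h))

      sum-▹ : ∀ g f → sum f ≈ sum (λ s → f (s ▹ g))
      sum-▹ g f = sum-permute f (permute g)

      eval-cong : ∀ (a : U.Carrier → Carrier) →
                  LocallyConstant (asProfiniteGroup S) a →
                  ∀ {u v} → u U.≈ v → a u ≈ a v
      eval-cong a (i , const) {u} {v} u≈v = const (U.Mod.≈⇒∼ i {u} {v} u≈v)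

    -- The value of cor α at g is Σ_s α(r_s g r_{s ▹ g}⁻¹), where (r_s) is
    -- the given right transversal of U.
    cor : Func (H (asProfiniteGroup S) 1) (H G 1)
    cor = record
      { to   = to
      ; cong = λ α∼β → ≈⇒∼ᶜ G λ g →
          sum-cong-≋ λ s → ∼ᶜ⇒≈ (asProfiniteGroup S) α∼β (step s g)
      }
      where
      to : Cocycle (asProfiniteGroup S) 1 → Cocycle G 1
      to α = cocycle¹ G (sum-step λ u _ → α.⟦ u ∷ [] ⟧)
        (sum-step-const _ (proj₁ α-const , λ {u} {v} _ → proj₂ α-const {u} {v}))
        λ g h → begin
          sum (λ s → α.⟦ step s (g ∙ h) ∷ [] ⟧)
            ≈⟨ sum-cong-≋ (λ s → trans
                 (eval-cong (λ u → α.⟦ u ∷ [] ⟧) α-const (step-∙ s g h))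
                 (additive _ α (step s g) (step (s ▹ g) h))) ⟩
          sum (λ s → α.⟦ step s g ∷ [] ⟧ + α.⟦ step (s ▹ g) h ∷ [] ⟧)
            ≈⟨ ∑-distrib-+ {n} _ _ ⟩
          sum (λ s → α.⟦ step s g ∷ [] ⟧) + sum (λ s → α.⟦ step (s ▹ g) h ∷ [] ⟧)
            ≈⟨ +-congˡ (sum-▹ g (λ s → α.⟦ step s h ∷ [] ⟧)) ⟨
          sum (λ s → α.⟦ step s g ∷ [] ⟧) + sum (λ s → α.⟦ step s h ∷ [] ⟧)  ∎
        where
        module α = Cocycle α
        α-const : LocallyConstant (asProfiniteGroup S) (λ u → α.⟦ u ∷ [] ⟧)
        α-const = locallyConstant _ α

    private
      restrict : Cocycle G 1 → Cocycle (asProfiniteGroup S) 1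
      restrict γ = cocycle¹ _ (λ (g , _) → eval¹ G γ g)
        (let i , const = locallyConstant G γ in i , λ e → const e)
        λ (g , _) (h , _) → additive G γ g h

    -- Projection formula: if α ⌣ res γ = δ ψ, then cor α ⌣ γ = δ φ for
    -- φ(g) = Σ_s (ψ(u_s) - α(u_s) γ(r_{s ▹ g})), where u_s = r_s g r_{s ▹ g}⁻¹.
    cor-𝓡 : ∀ α → (∀ β → _∼ᶜ_ (asProfiniteGroup S) (_⌣_ _ α β) (0ᴴ _)) →
            ∀ γ → _∼ᶜ_ G (_⌣_ G (Func.to cor α) γ) (0ᴴ G)
    cor-𝓡 α α⌣≈0 γ with α⌣≈0 (restrict γ)
    ... | cohomologous (ψ , α⌣γ≈δψ) = cohomologous
      ( cochain¹ G (sum-step Φ) (sum-step-const Φ Φ-const)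
      , λ { (g ∷ h ∷ []) → trans x-0≈x (move (main g h)) }
      )
      where
      module α = Cocycle α
      a : U.Carrier → Carrier
      a u = α.⟦ u ∷ [] ⟧

      c : G.Carrier → Carrier
      c = eval¹ G γ

      Ψ : U.Carrier → Carrier
      Ψ u = Cochain.⟦_⟧ ψ (u ∷ [])

      Ψ-const : LocallyConstant (asProfiniteGroup S) Ψ
      Ψ-const = let i , const = Cochain.continuous ψ in i , λ e → const (e ∷ [])

      c-cong : ∀ {g h} → g G.≈ h → c g ≈ c h
      c-cong e = let i , const = locallyConstant G γ in const (G.Mod.≈⇒∼ i e)

      x-0≈x : ∀ {x} → x - 0# ≈ x
      x-0≈x {x} = trans (+-congˡ ε⁻¹≈ε) (+-identityʳ x)

      Φ : U.Carrier → Fin n → Carrier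
      Φ u t = Ψ u + a u * - c (rep t)

      Φ-const : ∃ λ i → ∀ {u v} t → u U.≈ v mod i → Φ u t ≈ Φ v t
      Φ-const =
        let
          i , ψ-const = Cochain.continuous ψ
          j , a-const = α.continuous
          k , k⊆i , k⊆j = G.directed i j
        in k , λ t e → +-cong (ψ-const (k⊆i e ∷ [])) (*-congʳ (a-const (k⊆j e ∷ [])))

      main : ∀ g h → sum (λ s → a (step s g)) * c h + sum-step Φ (g ∙ h) ≈
                     sum-step Φ h + sum-step Φ g
      main g h = begin
        sum (λ s → a (step s g)) * c h + sum-step Φ (g ∙ h)
          ≈⟨ +-congʳ (*-distribʳ-sum (c h) (λ s → a (step s g))) ⟩
        sum (λ s → a (step s g) * c h) + sum-step Φ (g ∙ h)
          ≈⟨ ∑-distrib-+ {n} _ _ ⟨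
        sum (λ s → a (step s g) * c h + Φ (step s (g ∙ h)) (s ▹ (g ∙ h)))
          ≈⟨ sum-cong-≋ termwise ⟩
        sum (λ s → Φ (step (s ▹ g) h) (s ▹ g ▹ h) + Φ (step s g) (s ▹ g))
          ≈⟨ ∑-distrib-+ {n} _ _ ⟩
        sum (λ s → Φ (step (s ▹ g) h) (s ▹ g ▹ h)) + sum-step Φ g
          ≈⟨ +-congʳ (sum-▹ g (λ s → Φ (step s h) (s ▹ h))) ⟨
        sum-step Φ h + sum-step Φ g  ∎
        where
        termwise : ∀ s → a (step s g) * c h + Φ (step s (g ∙ h)) (s ▹ (g ∙ h)) ≈
                         Φ (step (s ▹ g) h) (s ▹ g ▹ h) + Φ (step s g) (s ▹ g)
        termwise s = begin
          a u * c h + (Ψ (step s (g ∙ h)) + a (step s (g ∙ h)) * - c (rep (s ▹ (g ∙ h))))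
            ≈⟨ +-congˡ (+-cong (eval-cong Ψ Ψ-const (step-∙ s g h)) (*-cong
                 (trans (eval-cong a (locallyConstant _ α) (step-∙ s g h)) (additive _ α u u′))
                 (reflexive (≡.cong (λ t → - c (rep t)) (▹-∙ s g h))))) ⟩
          a u * c h + (Ψ (u U.∙ u′) + (a u + a u′) * - c r″)
            ≈⟨ solve 6 (λ x y z w v d →
                 (x ⊗ y ⊕ (z ⊕ (x ⊕ w) ⊗ d)) ⊜ (x ⊗ (y ⊕ d) ⊕ z ⊕ w ⊗ d))
                 refl (a u) (c h) (Ψ (u U.∙ u′)) (a u′) (Ψ u) (- c r″) ⟩
          a u * (c h - c r″) + Ψ (u U.∙ u′) + a u′ * - c r″
            ≈⟨ +-congʳ (+-congʳ (*-congˡ c-u′)) ⟨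
          a u * (c (proj₁ u′) - c r′) + Ψ (u U.∙ u′) + a u′ * - c r″
            ≈⟨ solve 5 (λ x y z w d →
                 (x ⊗ (y ⊕ d) ⊕ z ⊕ w) ⊜ ((x ⊗ y ⊕ z) ⊕ (x ⊗ d ⊕ w)))
                 refl (a u) (c (proj₁ u′)) (Ψ (u U.∙ u′)) (a u′ * - c r″) (- c r′) ⟩
          (a u * c (proj₁ u′) + Ψ (u U.∙ u′)) + (a u * - c r′ + a u′ * - c r″)
            ≈⟨ +-congʳ (unmove (trans (sym x-0≈x) (α⌣γ≈δψ (u ∷ u′ ∷ [])))) ⟩
          (Ψ u′ + Ψ u) + (a u * - c r′ + a u′ * - c r″)
            ≈⟨ solve 4 (λ x y z w → ((x ⊕ y) ⊕ (z ⊕ w)) ⊜ ((x ⊕ w) ⊕ (y ⊕ z)))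
                 refl (Ψ u′) (Ψ u) (a u * - c r′) (a u′ * - c r″) ⟩
          (Ψ u′ + a u′ * - c r″) + (Ψ u + a u * - c r′)  ∎
          where
          u  = step s g
          u′ = step (s ▹ g) h
          r′ = rep (s ▹ g)
          r″ = rep (s ▹ g ▹ h)

          c-u′ : c (proj₁ u′) - c r′ ≈ c h - c r″
          c-u′ = exchange (begin
            c (proj₁ u′) + c r″   ≈⟨ additive G γ (proj₁ u′) r″ ⟨
            c (proj₁ u′ ∙ r″)     ≈⟨ c-cong (GroupProperties.//-rightDividesˡ G.group r″ (r′ ∙ h)) ⟩
            c (r′ ∙ h)            ≈⟨ additive G γ r′ h ⟩
            c r′ + c h            ∎)

    cor-𝓡-map : Func (𝓡 (asProfiniteGroup S)) (𝓡 G)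
    cor-𝓡-map = record
      { to   = λ (α , α⌣≈0) → Func.to cor α , cor-𝓡 α α⌣≈0
      ; cong = Func.cong cor
      }

KijimaNishi : ℕ → ProfiniteGroup → Set₁
KijimaNishi p G = (S : OpenSubgroup G p) → IsNormal S →
  Surjective (Setoid._≈_ (𝓡 (asProfiniteGroup S))) (Setoid._≈_ (𝓡 G))
    (Func.to (cor-𝓡-map S))
  where open Cohomology (𝔽 p)

-- An element of the inverse limit of the rings ℤ/pⁿ, by representatives.
record ℤₚ (p : ℕ) : Set where
  field
    approx     : ℕ → ℕ
    compatible : ∀ n → p ℕ.^ n ∣ ∣ approx (suc n) - approx n ∣
open ℤₚ

0ℤₚ : ∀ {p} → ℤₚ p
0ℤₚ {p} = record { approx = λ _ → 0 ; compatible = λ n → (p ℕ.^ n) ∣0 }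

_∈_ℤₚ : ∀ {p} → ℤₚ p → ℕ → Set
_∈_ℤₚ {p} λ′ m =
  Σ (ℤₚ p) λ μ → ∀ n → p ℕ.^ n ∣ ∣ approx λ′ n - m ℕ.* approx μ n ∣

0∈ : ∀ {p} m → 0ℤₚ {p} ∈ m ℤₚ
0∈ {p} m = 0ℤₚ , divides
  where
  divides : ∀ n → p ℕ.^ n ∣ ∣ 0 - m ℕ.* 0 ∣
  divides n rewrite ℕ.*-zeroʳ m = (p ℕ.^ n) ∣0

module _ (G : ProfiniteGroup) where
  open ProfiniteGroup G

  _^_ : Carrier → ℕ → Carrier
  g ^ n = n · g
    where open RawMonoid rawMonoid renaming (_×_ to _·_)

  -- With g ∙ h ∙ g ⁻¹ ∙ h ⁻¹ instead one obtains the same class of groups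
  -- below: invert the generators and negate the labels.
  commutator : Carrier → Carrier → Carrier
  commutator g h = g ⁻¹ ∙ h ⁻¹ ∙ g ∙ h

  -- y = g ^ λ, the limit of the powers g ^ approx λ n.
  IsPower : ∀ {p} → Carrier → ℤₚ p → Carrier → Set
  IsPower g λ′ y = ∀ i → ∃ λ n₀ → ∀ n → n₀ ℕ.≤ n → y ≈ g ^ approx λ′ n mod i

record DirectedGraph : Set where
  field
    order      : ℕ
    edge       : Fin order → Fin order → Bool
    asymmetric : ∀ v w → T (edge v w) → ¬ T (edge w v)

  Vertex : Set
  Vertex = Fin order

  Edge : Vertex → Vertex → Set
  Edge v w = T (edge v w)

labelModulus : ℕ → ℕ
labelModulus 2 = 4
labelModulus p = p

Label : ℕ → Set
Label p = Σ (ℤₚ p) (_∈ labelModulus p ℤₚ)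

Labelling : ℕ → DirectedGraph → Set
Labelling p Γ = ∀ v w → Edge v w → Label p × Label p
  where open DirectedGraph Γ

module _ {p : ℕ} (Γ : DirectedGraph) (f : Labelling p Γ) where
  open DirectedGraph Γ

  -- The relations [v , w] = v ^ λ₁ ∙ w ^ λ₂ hold in G for the images of the
  -- vertices under ι.
  Relations : (G : ProfiniteGroup) → (Vertex → ProfiniteGroup.Carrier G) → Set
  Relations G ι = ∀ v w (e : Edge v w) →
    let (λ₁ , _) , (λ₂ , _) = f v w e in
    ∃ λ x → ∃ λ y → IsPower G (ι v) λ₁ x × IsPower G (ι w) λ₂ y ×
      commutator G (ι v) (ι w) ≈ x ∙ y
    where open ProfiniteGroup G

  -- G is the pro-p group with generators Vertex subject to Relations,
  -- i.e. it is initial among pro-p groups with such a family of elements.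
  record IsPresented (G : ProfiniteGroup) : Set₁ where
    open ProfiniteGroup using (Carrier)
    open ContinuousHomomorphism using (⟦_⟧)
    field
      isPro     : IsPro p G
      ι         : Vertex → Carrier G
      relations : Relations G ι
      lift      : ∀ H (ρ : Vertex → Carrier H) → IsPro p H → Relations H ρ →
                  ContinuousHomomorphism G H
      lift-ι    : ∀ H ρ pro rel v →
                  ProfiniteGroup._≈_ H (⟦ lift H ρ pro rel ⟧ (ι v)) (ρ v)
      unique    : ∀ H → IsPro p H → (φ ψ : ContinuousHomomorphism G H) →
                  (∀ v → ProfiniteGroup._≈_ H (⟦ φ ⟧ (ι v)) (⟦ ψ ⟧ (ι v))) →
                  ∀ g → ProfiniteGroup._≈_ H (⟦ φ ⟧ g) (⟦ ψ ⟧ g)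

IsGeneralizedRAAG : ℕ → ProfiniteGroup → Set₁
IsGeneralizedRAAG p G =
  Σ DirectedGraph λ Γ → Σ (Labelling p Γ) λ f → IsPresented Γ f G

0-labelling : ∀ {p Γ} → Labelling p Γ
0-labelling {p} _ _ _ = (0ℤₚ , 0∈ m) , (0ℤₚ , 0∈ m)
  where m = labelModulus p

IsRAAG : ∀ p → DirectedGraph → ProfiniteGroup → Set₁
IsRAAG p Γ G = IsPresented {p} Γ (0-labelling {p} {Γ}) G

record AutomorphismOfOrderTwo (G : ProfiniteGroup) : Set where
  open ProfiniteGroup G
  field
    homomorphism : ContinuousHomomorphism G G
  open ContinuousHomomorphism homomorphism public
  field
    involutive : ∀ g → ⟦ ⟦ g ⟧ ⟧ ≈ g
    nontrivial : ¬ (∀ g → ⟦ g ⟧ ≈ g)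

-- The semidirect product with Δ = {1,x₀}, represented by (Bool , _xor_),
-- in which x₀ = true acts by a.
module _ (G : ProfiniteGroup) (a : AutomorphismOfOrderTwo G) where
  open ProfiniteGroup G
  open AutomorphismOfOrderTwo a

  private
    open GroupProperties group
    open ≈-Reasoning setoid

    act : Bool → Carrier → Carrier
    act false g = g
    act true  g = ⟦ g ⟧

    act-cong : ∀ s {g h} → g ≈ h → act s g ≈ act s h
    act-cong false e = e
    act-cong true  e = ⟦⟧-cong e

    act-∙ : ∀ s g h → act s (g ∙ h) ≈ act s g ∙ act s h
    act-∙ false g h = refl
    act-∙ true  g h = homo g h

    act-⁻¹ : ∀ s g → act s (g ⁻¹) ≈ act s g ⁻¹
    act-⁻¹ false g = refl
    act-⁻¹ true  g = ⁻¹-homo g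

    act-ε : ∀ s → act s ε ≈ ε
    act-ε false = refl
    act-ε true  = ε-homo

    act-xor : ∀ s t g → act (s xor t) g ≈ act s (act t g)
    act-xor false t     g = refl
    act-xor true  false g = refl
    act-xor true  true  g = sym (involutive g)

    act-same : ∀ s g → act s (act s g) ≈ g
    act-same s g = begin
      act s (act s g)    ≈⟨ act-xor s s g ⟨
      act (s xor s) g    ≡⟨ ≡.cong (λ t → act t g) (Bool.xor-same s) ⟩
      g                  ∎

    semidirect : Group 0ℓ 0ℓ
    semidirect = record
      { Carrier = Carrier × Bool
      ; _≈_     = λ (g , s) (h , t) → g ≈ h × s ≡ t
      ; _∙_     = λ (g , s) (h , t) → g ∙ act s h , s xor t
      ; ε       = ε , false
      ; _⁻¹     = λ (g , s) → act s (g ⁻¹) , s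
      ; isGroup = record
        { isMonoid = record
          { isSemigroup = record
            { isMagma = record
              { isEquivalence = record
                { refl  = refl , ≡.refl
                ; sym   = λ (e , e′) → sym e , ≡.sym e′
                ; trans = λ (e , e′) (d , d′) → trans e d , ≡.trans e′ d′
                }
              ; ∙-cong = λ { {x = _ , s} (e , ≡.refl) (d , ≡.refl) →
                  ∙-cong e (act-cong s d) , ≡.refl }
              }
            ; assoc = λ (g , s) (h , t) (k , u) →
                (begin
                  g ∙ act s h ∙ act (s xor t) k      ≈⟨ assoc _ _ _ ⟩
                  g ∙ (act s h ∙ act (s xor t) k)    ≈⟨ ∙-congˡ (∙-congˡ (act-xor s t k)) ⟩
                  g ∙ (act s h ∙ act s (act t k))    ≈⟨ ∙-congˡ (act-∙ s _ _) ⟨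
                  g ∙ act s (h ∙ act t k)            ∎)
                , Bool.xor-assoc s t u
            }
          ; identity = (λ (g , _) → identityˡ g , ≡.refl)
                     , (λ (g , s) → trans (∙-congˡ (act-ε s)) (identityʳ g)
                                  , Bool.xor-identityʳ s)
          }
        ; inverse =
            (λ (g , s) →
              (begin
                act s (g ⁻¹) ∙ act s g  ≈⟨ act-∙ s _ _ ⟨
                act s (g ⁻¹ ∙ g)        ≈⟨ act-cong s (inverseˡ g) ⟩
                act s ε                 ≈⟨ act-ε s ⟩
                ε                       ∎)
              , Bool.xor-same s)
          , (λ (g , s) →
              (begin
                g ∙ act s (act s (g ⁻¹))  ≈⟨ ∙-congˡ (act-same s _) ⟩
                g ∙ g ⁻¹                  ≈⟨ inverseʳ g ⟩
                ε                         ∎)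
              , Bool.xor-same s)
        ; ⁻¹-cong = λ { {_ , s} (e , ≡.refl) → act-cong s (⁻¹-cong e) , ≡.refl }
        }
      }

    -- The a-invariant subgroups N i ∩ a⁻¹(N i) form a base in G ⋊ Δ.
    M : Ix → Pred (Carrier × Bool) 0ℓ
    M i (g , s) = (∀ t → N i (act t g)) × s ≡ false

    M-normal : ∀ i → IsNormalSubgroup semidirect (M i)
    M-normal i = record
      { isSubgroup = record
        { respects  = λ { (e , ≡.refl) (m , s≡0) →
            (λ t → respects (act-cong t e) (m t)) , s≡0 }
        ; ε-closed  = (λ t → respects (sym (act-ε t)) ε-closed) , ≡.refl
        ; ∙-closed  = λ { (m , ≡.refl) (m′ , ≡.refl) →
            (λ t → respects (sym (act-∙ t _ _)) (∙-closed (m t) (m′ t))) , ≡.refl }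
        ; ⁻¹-closed = λ { (m , ≡.refl) →
            (λ t → respects (sym (act-⁻¹ t _)) (⁻¹-closed (m t))) , ≡.refl }
        }
      ; conj-closed = λ { (h , s) {g , _} (m , ≡.refl) → conj h s g m }
      }
      where
      open IsNormalSubgroup (N-normal i)

      conj : ∀ h s g → (∀ t → N i (act t g)) →
             M i (h ∙ act s g ∙ act (s xor false) (act s (h ⁻¹)) , (s xor false) xor s)
      conj h s g m rewrite Bool.xor-identityʳ s | Bool.xor-same s =
        (λ t → respects (sym (eq t)) (conj-closed (act t h) (m (t xor s)))) , ≡.refl
        where
        eq : ∀ t → act t (h ∙ act s g ∙ act s (act s (h ⁻¹))) ≈
                   act t h ∙ act (t xor s) g ∙ act t h ⁻¹
        eq t = begin
          act t (h ∙ act s g ∙ act s (act s (h ⁻¹)))  ≈⟨ act-cong t (∙-congˡ (act-same s _)) ⟩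
          act t (h ∙ act s g ∙ h ⁻¹)                  ≈⟨ act-∙ t _ _ ⟩
          act t (h ∙ act s g) ∙ act t (h ⁻¹)          ≈⟨ ∙-cong (act-∙ t _ _) (act-⁻¹ t h) ⟩
          act t h ∙ act t (act s g) ∙ act t h ⁻¹      ≈⟨ ∙-congʳ (∙-congˡ (act-xor t s g)) ⟨
          act t h ∙ act (t xor s) g ∙ act t h ⁻¹      ∎

    -- N (refine i) is contained in N i ∩ a⁻¹(N i).
    refine : Ix → Ix
    refine i = proj₁ (directed i (proj₁ (continuous i)))

    refine-⊆ : ∀ i t {g} → N (refine i) g → N i (act t g)
    refine-⊆ i false = proj₁ (proj₂ (directed i (proj₁ (continuous i))))
    refine-⊆ i true  =
      proj₂ (continuous i) ∘ proj₂ (proj₂ (directed i (proj₁ (continuous i))))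

    refine-mod : ∀ i s {g h} → g ≈ h mod refine i →
                 SameCoset semidirect (M i) (g , s) (h , s)
    refine-mod i s g∼h =
      (λ t → IsNormalSubgroup.respects (N-normal i)
        (act-cong t (∙-congˡ (sym (act-same s _)))) (refine-⊆ i t g∼h))
      , Bool.xor-same s

    project : ∀ i {g h} s t → s ≡ t →
              SameCoset semidirect (M i) (g , s) (h , t) → g ≈ h mod i
    project i s _ ≡.refl (m , _) =
      IsNormalSubgroup.respects (N-normal i) (∙-congˡ (act-same s _)) (m false)

    N⊆⇒M⊆ : ∀ {i j} → N j ⊆ N i → M j ⊆ M i
    N⊆⇒M⊆ j⊆i (m , s≡0) = (λ t → j⊆i (m t)) , s≡0

    M-finite : ∀ i → ∃ (HasIndex semidirect (M i))
    M-finite i = Cosets.finiteIndex (IsNormalSubgroup.isSubgroup (M-normal i))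
      M? (List.cartesianProduct xs (false ∷ true ∷ [])) covered
      where
      open SubgroupProperties semidirect
      k : Ix
      k = refine i

      xs : List Carrier
      xs = proj₁ (Mod.representatives k (proj₂ (N-finite k)))

      covers : ∀ g → Any (λ x → g ≈ x mod k) xs
      covers = proj₂ (Mod.representatives k (proj₂ (N-finite k)))

      M? : ∀ g → Dec (M i g)
      M? (g , s) = Dec.map′
        (λ (m , m′) → λ { false → m ; true → m′ }) (λ m → m false , m true)
        (N? g Dec.×-dec N? ⟦ g ⟧) Dec.×-dec (s Bool.≟ false)
        where N? = Mod.∈? i (proj₂ (N-finite i))

      any-Bool : ∀ {P : Pred Bool 0ℓ} s → P s → Any P (false ∷ true ∷ [])
      any-Bool false p = here p
      any-Bool true  p = there (here p)

      covered : ∀ g → Any (SameCoset semidirect (M i) g)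
                        (List.cartesianProduct xs (false ∷ true ∷ []))
      covered (g , s) = Any.cartesianProductWith⁺ _,_
        (λ { g∼x ≡.refl → refine-mod i s g∼x }) (covers g) (any-Bool {s ≡_} s ≡.refl)

    M-complete : (x : Ix → Carrier × Bool) →
                 (∀ {i j} → M j ⊆ M i → SameCoset semidirect (M i) (x j) (x i)) →
                 ∃ λ g → ∀ i → SameCoset semidirect (M i) g (x i)
    M-complete x compatible = (g , s₀) , limit
      where
      xor≡false : ∀ s t → s xor t ≡ false → s ≡ t
      xor≡false false t e = ≡.sym e
      xor≡false true true e = ≡.refl

      compat : ∀ {i j} → N j ⊆ N i → SameCoset semidirect (M i) (x j) (x i)
      compat {i} {j} j⊆i = compatible λ {g} → N⊆⇒M⊆ j⊆i {g}

      sign : ∀ {i j} → N j ⊆ N i → proj₂ (x j) ≡ proj₂ (x i)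
      sign j⊆i = xor≡false _ _ (proj₂ (compat j⊆i))

      s₀ : Bool
      s₀ = proj₂ (x inhabited)

      sign₀ : ∀ i → s₀ ≡ proj₂ (x i)
      sign₀ i = let k , k⊆₀ , k⊆i = directed inhabited i in
        ≡.trans (≡.sym (sign k⊆₀)) (sign k⊆i)

      lim : ∃ λ g → ∀ i → g ≈ proj₁ (x i) mod i
      lim = complete (proj₁ ∘ x) λ {i} {j} j⊆i →
        project i (proj₂ (x j)) (proj₂ (x i)) (sign j⊆i) (compat j⊆i)

      g : Carrier
      g = proj₁ lim

      limit : ∀ i → SameCoset semidirect (M i) (g , s₀) (x i)
      limit i = SubgroupProperties.Cosets.∼-trans semidirect
        (IsNormalSubgroup.isSubgroup (M-normal i))
        {g , s₀} {x k} {x i}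
        (≡.subst (λ s → SameCoset semidirect (M i) (g , s) (x k)) (≡.sym (sign₀ k))
          (refine-mod i (proj₂ (x k)) (proj₂ lim k)))
        (compat (refine-⊆ i false))
        where k = refine i

  semidirectProduct : ProfiniteGroup
  semidirectProduct = record
    { group     = semidirect
    ; Ix        = Ix
    ; N         = M
    ; N-normal  = M-normal
    ; N-finite  = M-finite
    ; inhabited = inhabited
    ; directed  = λ i j → let k , k⊆i , k⊆j = directed i j in
                  k , (λ {g} → N⊆⇒M⊆ k⊆i {g}) , (λ {g} → N⊆⇒M⊆ k⊆j {g})
    ; separated = λ m → separated (λ i → proj₁ (m i) false) , proj₂ (m inhabited)
    ; complete  = M-complete
    }

record IsΔRAAG (G : ProfiniteGroup) : Set₁ where
  field
    Γ      : DirectedGraph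
    A      : ProfiniteGroup
    isRAAG : IsRAAG 2 Γ A

  open DirectedGraph Γ
  open ProfiniteGroup A
  open IsPresented isRAAG using (ι)

  field
    z   : Vertex → Carrier
    a   : AutomorphismOfOrderTwo A
    a-ι : ∀ v → AutomorphismOfOrderTwo.⟦_⟧ a (ι v) ≈ z v ∙ ι v ⁻¹ ∙ z v ⁻¹
    iso : G ≅ semidirectProduct A a

{-# OPTIONS --safe #-}
-- Generalized RAAGs.  If α cups trivially with H¹(G) then pairing it with the
-- characters dual to the generators shows that α vanishes at the ends of every
-- edge.  Let U be normal of index p.  A cup product α′ ⌣ β of classes on U
-- vanishes if (α′ , β) lifts to the Heisenberg group over 𝔽ₚ; by Shapiro's
-- lemma, such lifts on U are homomorphisms from G to the wreath product of the
-- Heisenberg group with G / U.  Send a generator v to (α(v) at the coset U, the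
-- crossed homomorphism of β at v, 0; v).  The relation of an edge holds, as its
-- ends have trivial α-part and so are mapped by the homomorphism that β induces
-- on all of G.  The α-part of the lift does not depend on β; it yields α′ with
-- cor α′ = α.
--
-- Δ-RAAGs.  Already α ⌣ χ₀ = 0, for the character χ₀ of G / A = Δ, forces α = 0:
-- for a cochain φ bounding it, x₀² = 1 gives α(x₀) = 0, and as x₀ inverts a
-- generator v up to conjugation in A, φ(x₀ v) = φ(a(v) x₀) gives α(v) = 2 φ(v) = 0.

module Submission where

open import Defs
open import Algebra.Bundles using (Group; CommutativeRing)
import Algebra.Definitions.RawMonoid as RawMonoid
import Algebra.Morphism.Construct.Composition as Composition
import Algebra.Properties.Group as GroupProperties
import Algebra.Properties.CommutativeMonoid.Sum as Summation
open import Data.Bool.Base using (Bool; true; false; if_then_else_; _xor_)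
open import Data.Fin.Base using (Fin; zero; suc; toℕ; fromℕ<; combine; funToFin; finToFun)
import Data.Fin.Properties as Fin
open import Data.Fin.Permutation using (permutation)
open import Data.Integer.Base as ℤ using (ℤ; +_; 0ℤ; 1ℤ)
import Data.Integer.DivMod as ℤ
import Data.Integer.Properties as ℤ
open import Data.Integer.Divisibility.Signed as ℤ using ()
open import Data.Integer.Tactic.RingSolver using ()
  renaming (solve-∀ to solve-∀-ℤ)
open import Data.Nat.Base as ℕ using (ℕ; NonZero; ∣_-_∣)
import Data.Nat.Properties as ℕ
open import Data.Nat.Divisibility as ℕ using (_∣_)
open import Data.Nat.Tactic.RingSolver using ()
  renaming (solve-∀ to solve-∀-ℕ)
open import Data.Nat.Primality using (Prime; prime; prime⇒nonZero; euclidsLemma)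
open import Data.Product.Base using (∃; _×_; _,_; proj₁; proj₂)
open import Data.Product.Function.NonDependent.Setoid using (_×-inverse_)
open import Data.Product.Relation.Binary.Pointwise.NonDependent using (_×ₛ_)
import Data.Vec.Functional.Relation.Binary.Equality.Setoid as Vector
open import Data.Sum.Base using (_⊎_; inj₁; inj₂; [_,_]′)
open import Data.Unit.Base using (⊤; tt)
open import Data.Vec.Base using ([]; _∷_)
open import Data.Vec.Relation.Binary.Pointwise.Inductive using ([]; _∷_)
open import Function.Base using (_∘_)
open import Function.Bundles using (Inverse; Func)
open import Level using (0ℓ)
open import Relation.Binary.Bundles using (Setoid)
open import Relation.Binary.PropositionalEquality as ≡ using (_≡_)
import Relation.Binary.Reasoning.Setoid as ≈-Reasoning
open import Relation.Nullary using (¬_; does; yes; no; contradiction)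

-- Finite setoids with a counted carrier, and finite p-groups as discrete profinite groups.

Enumeration : Setoid 0ℓ 0ℓ → ℕ → Set
Enumeration S n = Inverse S (≡.setoid (Fin n))

×-enumeration : ∀ {S T m n} → Enumeration S m → Enumeration T n →
                Enumeration (S ×ₛ T) (m ℕ.* n)
×-enumeration {m = m} {n} S↔m T↔n = record
  { to        = λ x → combine (proj₁ (to x)) (proj₂ (to x))
  ; from      = from ∘ Inverse.to (Fin.*↔× {m} {n})
  ; to-cong   = λ e → ≡.cong₂ combine (proj₁ (to-cong e)) (proj₂ (to-cong e))
  ; from-cong = λ { ≡.refl → from-cong (≡.refl , ≡.refl) }
  ; inverse   =
      (λ e → ≡.trans
        (≡.cong₂ combine (proj₁ (inverseˡ e)) (proj₂ (inverseˡ e)))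
        (Fin.combine-remQuot {m} n _))
    , λ { ≡.refl → inverseʳ (≡⇒× (Fin.remQuot-combine {m} _ _)) }
  }
  where
  open Inverse (S↔m ×-inverse T↔n)

  ≡⇒× : ∀ {A B : Set} {x y : A × B} → x ≡ y → proj₁ x ≡ proj₁ y × proj₂ x ≡ proj₂ y
  ≡⇒× ≡.refl = ≡.refl , ≡.refl

funToFin-cong : ∀ {m n} {f g : Fin m → Fin n} → (∀ i → f i ≡ g i) →
                funToFin f ≡ funToFin g
funToFin-cong {ℕ.zero}  f≗g = ≡.refl
funToFin-cong {ℕ.suc m} f≗g = ≡.cong₂ combine (f≗g zero) (funToFin-cong (f≗g ∘ suc))

power-enumeration : ∀ {S n} m → Enumeration S n →
                    Enumeration (Vector.≋-setoid S m) (n ℕ.^ m)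
power-enumeration {S} {n} m S↔n = record
  { to        = λ f → funToFin (to ∘ f)
  ; from      = λ k → from ∘ finToFun k
  ; to-cong   = λ f≋g → funToFin-cong (to-cong ∘ f≋g)
  ; from-cong = λ { ≡.refl i → Setoid.refl S }
  ; inverse   =
      (λ {k} f≋ → ≡.trans (funToFin-cong (inverseˡ ∘ f≋)) (Fin.funToFin-finToFin {m} {n} k))
    , λ { {f} ≡.refl i → inverseʳ (Fin.finToFun-funToFin (to ∘ f) i) }
  }
  where open Inverse S↔n

record FinitePGroup (p : ℕ) : Set₁ where
  field
    group       : Group 0ℓ 0ℓ
    logOrder    : ℕ
    enumeration : Enumeration (Group.setoid group) (p ℕ.^ logOrder)
  open Group group public

module _ {p : ℕ} (K : FinitePGroup p) where
  open FinitePGroup K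
  open GroupProperties group using (x≈y⇒x∙y⁻¹≈ε; x∙y⁻¹≈ε⇒x≈y; ε⁻¹≈ε)
  open Inverse enumeration using (to; from; to-cong; strictlyInverseˡ; strictlyInverseʳ)
  private
    trivial-index : HasIndex group (_≈ ε) (p ℕ.^ logOrder)
    trivial-index = record
      { rep           = from
      ; coset         = to
      ; rep-coset     = λ g → x≈y⇒x∙y⁻¹≈ε (sym (strictlyInverseʳ g))
      ; rep-injective = λ {s} {t} e → ≡.trans (≡.sym (strictlyInverseˡ s))
          (≡.trans (to-cong (x∙y⁻¹≈ε⇒x≈y _ _ e)) (strictlyInverseˡ t))
      }

  discrete : ProfiniteGroup
  discrete = record
    { group     = group
    ; Ix        = ⊤
    ; N         = λ _ → _≈ ε
    ; N-normal  = λ _ → record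
      { isSubgroup = record
        { respects  = λ x≈y x≈ε → trans (sym x≈y) x≈ε
        ; ε-closed  = refl
        ; ∙-closed  = λ g≈ε h≈ε → trans (∙-cong g≈ε h≈ε) (identityˡ ε)
        ; ⁻¹-closed = λ g≈ε → trans (⁻¹-cong g≈ε) ε⁻¹≈ε
        }
      ; conj-closed = λ g u≈ε →
          trans (∙-congʳ (trans (∙-congˡ u≈ε) (identityʳ g))) (inverseʳ g)
      }
    ; N-finite  = λ _ → p ℕ.^ logOrder , trivial-index
    ; inhabited = tt
    ; directed  = λ _ _ → tt , (λ e → e) , λ e → e
    ; separated = λ e → e tt
    ; complete  = λ x _ → x tt , λ _ → inverseʳ (x tt)
    }

  discrete-isPro : IsPro p discrete
  discrete-isPro _ = logOrder , trivial-index

module _ (G : ProfiniteGroup) {p : ℕ} (K : FinitePGroup p) where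
  private
    module G = ProfiniteGroup G
    module K = FinitePGroup K
    module KP = GroupProperties K.group

  -- Local constancy serves twice: equal elements agree modulo every `N i`, so `f` respects `≈`; and
  -- `f` is trivial on `N i`, so it is continuous.
  toDiscrete : (f : G.Carrier → K.Carrier) → (∀ g h → f (g G.∙ h) K.≈ f g K.∙ f h) →
               (∃ λ i → ∀ {g h} → g G.≈ h mod i → f g K.≈ f h) →
               ContinuousHomomorphism G (discrete K)
  toDiscrete f homo (i , const) = record
    { ⟦_⟧ = f
    ; isGroupHomomorphism = record
      { isMonoidHomomorphism = record
        { isMagmaHomomorphism = record
          { isRelHomomorphism = record { cong = cong }
          ; homo = homo
          }
        ; ε-homo = ε-homo
        }
      ; ⁻¹-homo = λ g → KP.inverseˡ-unique _ _
          (K.trans (K.sym (homo _ _)) (K.trans (cong (G.inverseˡ g)) ε-homo))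
      }
    ; continuous = λ _ → i , λ g∈N → K.trans (const (G.Mod.∈⇒ε∼ i g∈N)) ε-homo
    }
    where
    cong : ∀ {g h} → g G.≈ h → f g K.≈ f h
    cong g≈h = const (G.Mod.≈⇒∼ i g≈h)

    ε-homo : f G.ε K.≈ K.ε
    ε-homo = KP.∙-cancelˡ (f G.ε) _ _ (K.trans (K.sym (homo _ _))
      (K.trans (cong (G.identityˡ G.ε)) (K.sym (K.identityʳ _))))

  -- The trivial subgroup of `K` is open, so the kernel of `φ` contains some `N i`.
  factors : (φ : ContinuousHomomorphism G (discrete K)) →
            ∃ λ i → ∀ {g h} → g G.≈ h mod i →
            ContinuousHomomorphism.⟦_⟧ φ g K.≈ ContinuousHomomorphism.⟦_⟧ φ h
  factors φ = let i , kernel = continuous tt in i , λ {g} {h} g∼h →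
    KP.x∙y⁻¹≈ε⇒x≈y _ _ (K.trans (K.∙-congˡ (K.sym (⁻¹-homo h)))
      (K.trans (K.sym (homo g (h G.⁻¹))) (kernel g∼h)))
    where open ContinuousHomomorphism φ

module _ {p : ℕ} (K L : FinitePGroup p) where
  private
    module K = FinitePGroup K
    module L = FinitePGroup L

  discreteHom : (f : K.Carrier → L.Carrier) → (∀ g h → f (g K.∙ h) L.≈ f g L.∙ f h) →
                (∀ {g h} → g K.≈ h → f g L.≈ f h) →
                ContinuousHomomorphism (discrete K) (discrete L)
  discreteHom f homo cong = toDiscrete (discrete K) L f homo
    (tt , λ e → cong (GroupProperties.x∙y⁻¹≈ε⇒x≈y K.group _ _ e))

-- Homomorphisms, p-adic powers and the defining relations.

infixr 9 _∘ʰ_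
_∘ʰ_ : ∀ {G H K} → ContinuousHomomorphism H K → ContinuousHomomorphism G H →
       ContinuousHomomorphism G K
_∘ʰ_ {K = K} ψ φ = record
  { ⟦_⟧ = ψ.⟦_⟧ ∘ φ.⟦_⟧
  ; isGroupHomomorphism = Composition.isGroupHomomorphism (ProfiniteGroup.trans K)
      φ.isGroupHomomorphism ψ.isGroupHomomorphism
  ; continuous = λ k → let j , j⊆k = ψ.continuous k ; i , i⊆j = φ.continuous j in
      i , λ g∈N → j⊆k (i⊆j g∈N)
  }
  where
  module ψ = ContinuousHomomorphism ψ
  module φ = ContinuousHomomorphism φ

-- The relation that `Relations` imposes for a single edge, isolated so that it can be carried along
-- homomorphisms and moved to equal elements.
RelationAt : ∀ {p} (H : ProfiniteGroup) → ProfiniteGroup.Carrier H →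
             ProfiniteGroup.Carrier H → ℤₚ p → ℤₚ p → Set
RelationAt H g h λ₁ λ₂ = ∃ λ x → ∃ λ y → IsPower H g λ₁ x × IsPower H h λ₂ y ×
  commutator H g h ≈ x ∙ y
  where open ProfiniteGroup H

module _ {G H : ProfiniteGroup} (φ : ContinuousHomomorphism G H) where
  private
    module G = ProfiniteGroup G
    module H = ProfiniteGroup H
  open ContinuousHomomorphism φ

  ^-homo : ∀ g n → ⟦ _^_ G g n ⟧ H.≈ _^_ H ⟦ g ⟧ n
  ^-homo g ℕ.zero    = ε-homo
  ^-homo g (ℕ.suc n) = H.trans (homo _ _) (H.∙-congˡ (^-homo g n))

  mod-homo : ∀ {i j} → (∀ {g} → G.N i g → H.N j ⟦ g ⟧) →
             ∀ {g h} → g G.≈ h mod i → ⟦ g ⟧ H.≈ ⟦ h ⟧ mod j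
  mod-homo {j = j} i⊆j g∼h = IsNormalSubgroup.respects (H.N-normal j)
    (H.trans (homo _ _) (H.∙-congˡ (⁻¹-homo _))) (i⊆j g∼h)

  IsPower-homo : ∀ {p} g (λ′ : ℤₚ p) {x} → IsPower G g λ′ x → IsPower H ⟦ g ⟧ λ′ ⟦ x ⟧
  IsPower-homo g λ′ g^λ≈x j =
    let i , i⊆j = continuous j
        n₀ , x∼g^n = g^λ≈x i
    in n₀ , λ n n₀≤n → H.Mod.∼-trans j (mod-homo i⊆j (x∼g^n n n₀≤n))
         (H.Mod.≈⇒∼ j (^-homo g (ℤₚ.approx λ′ n)))

  commutator-homo : ∀ g h → ⟦ commutator G g h ⟧ H.≈ commutator H ⟦ g ⟧ ⟦ h ⟧
  commutator-homo g h = H.trans (homo _ _) (H.∙-congʳ (H.trans (homo _ _)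
    (H.∙-congʳ (H.trans (homo _ _) (H.∙-cong (⁻¹-homo g) (⁻¹-homo h))))))

  RelationAt-homo : ∀ {p} g h (λ₁ λ₂ : ℤₚ p) → RelationAt G g h λ₁ λ₂ →
                    RelationAt H ⟦ g ⟧ ⟦ h ⟧ λ₁ λ₂
  RelationAt-homo g h λ₁ λ₂ (x , y , g^λ₁≈x , h^λ₂≈y , relation) =
    ⟦ x ⟧ , ⟦ y ⟧ , IsPower-homo g λ₁ g^λ₁≈x , IsPower-homo h λ₂ h^λ₂≈y ,
    H.trans (H.sym (commutator-homo _ _)) (H.trans (⟦⟧-cong relation) (homo x y))

module _ (H : ProfiniteGroup) where
  open ProfiniteGroup H

  ^-cong : ∀ {g h} → g ≈ h → ∀ n → _^_ H g n ≈ _^_ H h n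
  ^-cong g≈h ℕ.zero    = refl
  ^-cong g≈h (ℕ.suc n) = ∙-cong g≈h (^-cong g≈h n)

  IsPower-cong : ∀ {p g h} (λ′ : ℤₚ p) {x} → g ≈ h → IsPower H g λ′ x → IsPower H h λ′ x
  IsPower-cong λ′ g≈h g^λ≈x i = let n₀ , x∼g^n = g^λ≈x i in n₀ , λ n n₀≤n →
    Mod.∼-trans i (x∼g^n n n₀≤n) (Mod.≈⇒∼ i (^-cong g≈h (ℤₚ.approx λ′ n)))

  RelationAt-cong : ∀ {p g g′ h h′} (λ₁ λ₂ : ℤₚ p) → g ≈ g′ → h ≈ h′ →
                    RelationAt H g h λ₁ λ₂ → RelationAt H g′ h′ λ₁ λ₂
  RelationAt-cong λ₁ λ₂ g≈g′ h≈h′ (x , y , g^λ₁≈x , h^λ₂≈y , relation) =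
    x , y , IsPower-cong λ₁ g≈g′ g^λ₁≈x , IsPower-cong λ₂ h≈h′ h^λ₂≈y ,
    trans (∙-cong (∙-cong (∙-cong (⁻¹-cong (sym g≈g′)) (⁻¹-cong (sym h≈h′)))
      (sym g≈g′)) (sym h≈h′)) relation

module _ {A : ProfiniteGroup} (a : AutomorphismOfOrderTwo A) where
  private
    module A = ProfiniteGroup A
    module a = AutomorphismOfOrderTwo a

  embed : ContinuousHomomorphism A (semidirectProduct A a)
  embed = record
    { ⟦_⟧ = λ g → g , false
    ; isGroupHomomorphism = record
      { isMonoidHomomorphism = record
        { isMagmaHomomorphism = record
          { isRelHomomorphism = record { cong = λ g≈h → g≈h , ≡.refl }
          ; homo = λ _ _ → A.refl , ≡.refl
          }
        ; ε-homo = A.refl , ≡.refl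
        }
      ; ⁻¹-homo = λ _ → A.refl , ≡.refl
      }
    -- The basic subgroups of the semidirect product are `a`-invariant, so both `g` and its image
    -- under `a` must lie in `N i`.
    ; continuous = λ i → let j , j⊆i = a.continuous i ; k , k⊆i , k⊆j = A.directed i j in
        k , λ g∈N → (λ { false → k⊆i g∈N ; true → j⊆i (k⊆j g∈N) }) , ≡.refl
    }

reindex : ∀ {S m n} → m ≡ n → Enumeration S m → Enumeration S n
reindex {S} = ≡.subst (Enumeration S)

-- Divisibility of the labels.

-- The binomial coefficient n(n-1)/2. It is the coefficient of `a g * b g` when a cochain bounding a
-- cup product is evaluated at the n-th power of `g`; see `φ-^`.
triangle : ℕ → ℕ
triangle ℕ.zero    = 0
triangle (ℕ.suc n) = n ℕ.+ triangle n

2*triangle : ∀ n → 2 ℕ.* triangle n ℕ.+ n ≡ n ℕ.* n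
2*triangle ℕ.zero    = ≡.refl
2*triangle (ℕ.suc n) = begin
  2 ℕ.* (n ℕ.+ triangle n) ℕ.+ ℕ.suc n            ≡⟨ regroup n (triangle n) ⟩
  (2 ℕ.* triangle n ℕ.+ n) ℕ.+ (2 ℕ.* n ℕ.+ 1)    ≡⟨ ≡.cong (ℕ._+ (2 ℕ.* n ℕ.+ 1)) (2*triangle n) ⟩
  n ℕ.* n ℕ.+ (2 ℕ.* n ℕ.+ 1)                     ≡⟨ square n ⟩
  ℕ.suc n ℕ.* ℕ.suc n                             ∎
  where
  open ≡.≡-Reasoning
  regroup : ∀ n t → 2 ℕ.* (n ℕ.+ t) ℕ.+ ℕ.suc n ≡ (2 ℕ.* t ℕ.+ n) ℕ.+ (2 ℕ.* n ℕ.+ 1)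
  regroup = solve-∀-ℕ
  square : ∀ n → n ℕ.* n ℕ.+ (2 ℕ.* n ℕ.+ 1) ≡ ℕ.suc n ℕ.* ℕ.suc n
  square = solve-∀-ℕ

4∣n⇒2∣triangle : ∀ {n} → 4 ∣ n → 2 ∣ triangle n
4∣n⇒2∣triangle {n} (ℕ.divides k ≡.refl) =
  ℕ.∣m+n∣m⇒∣n (≡.subst (2 ∣_) (≡.sym halved) (ℕ.m∣m*n (4 ℕ.* (k ℕ.* k)))) (ℕ.m∣m*n k)
  where
  t : ℕ
  t = triangle (k ℕ.* 4)
  -- Half of the identity `2*triangle` at n = 4k. The right-hand side and `2 ℕ.* k` are both even,
  -- hence so is `t`.
  halved : 2 ℕ.* k ℕ.+ t ≡ 2 ℕ.* (4 ℕ.* (k ℕ.* k))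
  halved = ℕ.*-cancelˡ-≡ _ _ 2 (≡.trans (regroup k t)
    (≡.trans (2*triangle (k ℕ.* 4)) (square k)))
    where
    regroup : ∀ k t → 2 ℕ.* (2 ℕ.* k ℕ.+ t) ≡ 2 ℕ.* t ℕ.+ k ℕ.* 4
    regroup = solve-∀-ℕ
    square : ∀ k → k ℕ.* 4 ℕ.* (k ℕ.* 4) ≡ 2 ℕ.* (2 ℕ.* (4 ℕ.* (k ℕ.* k)))
    square = solve-∀-ℕ

∣∣m-d*n∣⇒∣m : ∀ {d} m n → d ∣ ∣ m - d ℕ.* n ∣ → d ∣ m
∣∣m-d*n∣⇒∣m {d} m n d∣ with ℕ.≤-total m (d ℕ.* n)
... | inj₁ m≤dn = ℕ.∣m+n∣m⇒∣n
  (≡.subst (d ∣_) (≡.sym (ℕ.m∸n+n≡m m≤dn)) (ℕ.m∣m*n n))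
  (≡.subst (d ∣_) (ℕ.m≤n⇒∣m-n∣≡n∸m m≤dn) d∣)
... | inj₂ dn≤m = ≡.subst (d ∣_) (ℕ.m∸n+n≡m dn≤m) (ℕ.∣m∣n⇒∣m+n
  (≡.subst (d ∣_) (≡.trans (ℕ.∣-∣-comm m _) (ℕ.m≤n⇒∣m-n∣≡n∸m dn≤m)) d∣) (ℕ.m∣m*n n))

^-monoʳ-∣ : ∀ d {m n} → m ℕ.≤ n → d ℕ.^ m ∣ d ℕ.^ n
^-monoʳ-∣ d {m} {n} m≤n = ≡.subst (d ℕ.^ m ∣_)
  (≡.trans (≡.sym (ℕ.^-distribˡ-+-* d m (n ℕ.∸ m))) (≡.cong (d ℕ.^_) (ℕ.m+[n∸m]≡n m≤n)))
  (ℕ.m∣m*n _)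

-- This is what the condition on labels is for. The bound 2 ≤ n makes 4 divide the modulus when p =
-- 2, and then n(n-1)/2 is even for n divisible by 4. For odd p, twice the binomial coefficient is
-- divisible by p, and p does not divide 2.
label-divisible : ∀ p → Prime p → (l : Label p) → ∀ n → 2 ℕ.≤ n →
                  let a = ℤₚ.approx (proj₁ l) n in p ∣ a × p ∣ triangle a
label-divisible 0 (prime ⦃ () ⦄ _)
label-divisible 1 (prime ⦃ () ⦄ _)
label-divisible 2 _ (λ′ , μ , λ≡4μ) n 2≤n =
  ℕ.∣-trans (ℕ.divides 2 ≡.refl) 4∣a , 4∣n⇒2∣triangle 4∣a
  where
  4∣a : 4 ∣ ℤₚ.approx λ′ n
  4∣a = ∣∣m-d*n∣⇒∣m _ (ℤₚ.approx μ n) (ℕ.∣-trans (^-monoʳ-∣ 2 2≤n) (λ≡4μ n))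
label-divisible p@(ℕ.suc (ℕ.suc (ℕ.suc k))) p-prime (λ′ , μ , λ≡pμ) n 2≤n = p∣a ,
  [ (λ p∣2 → contradiction (ℕ.∣⇒≤ p∣2) λ { (ℕ.s≤s (ℕ.s≤s ())) }) , (λ p∣t → p∣t) ]′
    (euclidsLemma 2 _ p-prime p∣2t)
  where
  a : ℕ
  a = ℤₚ.approx λ′ n
  p∣a : p ∣ a
  p∣a = ∣∣m-d*n∣⇒∣m _ (ℤₚ.approx μ n)
    (ℕ.∣-trans (ℕ.∣-trans (ℕ.m∣m*n 1) (^-monoʳ-∣ p (ℕ.<⇒≤ 2≤n))) (λ≡pμ n))
  p∣2t : p ∣ 2 ℕ.* triangle a
  p∣2t = ℕ.∣m+n∣m⇒∣n (≡.subst (p ∣_) (≡.trans (≡.sym (2*triangle a)) (ℕ.+-comm _ a))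
    (ℕ.∣m⇒∣m*n a p∣a)) p∣a

-- Arithmetic modulo p.

∣m⊖n∣≡∣m-n∣ : ∀ m n → ℤ.∣ m ℤ.⊖ n ∣ ≡ ∣ m - n ∣
∣m⊖n∣≡∣m-n∣ m n with ℕ.≤-total m n
... | inj₁ m≤n = ≡.trans (ℤ.∣⊖∣-≤ m≤n) (≡.sym (ℕ.m≤n⇒∣m-n∣≡n∸m m≤n))
... | inj₂ n≤m = ≡.trans (ℤ.∣m⊖n∣≡∣n⊖m∣ m n) (≡.trans (ℤ.∣⊖∣-≤ n≤m)
  (≡.trans (≡.sym (ℕ.m≤n⇒∣m-n∣≡n∸m n≤m)) (ℕ.∣-∣-comm n m)))

module ModP (p : ℕ) (p-prime : Prime p) where
  open CommutativeRing (𝔽 p) public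
    using (_≈_; refl; sym; trans; reflexive; setoid; +-group; _+_; _*_; -_; _-_;
           +-cong; *-cong; -‿cong)
  private
    instance
      p≢0 : NonZero p
      p≢0 = prime⇒nonZero p-prime

  +≈0 : ∀ {n} → p ∣ n → + n ≈ 0ℤ
  +≈0 {n} p∣n = congruent (ℤ.∣ᵤ⇒∣ (≡.subst (p ∣_) (≡.cong ℤ.∣_∣ (≡.sym (ℤ.+-identityʳ (+ n)))) p∣n))

  -- Two residues differ by less than `p`, and the only multiple of `p` that small is 0.
  residue-injective : ∀ {i j : Fin p} → + toℕ i ≈ + toℕ j → i ≡ j
  residue-injective {i} {j} (congruent p∣i-j) = Fin.toℕ-injective
    (ℕ.∣m-n∣≡0⇒m≡n (small (Fin.toℕ<n i) (Fin.toℕ<n j)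
      (≡.subst (p ∣_) (≡.trans (≡.cong ℤ.∣_∣ (ℤ.m-n≡m⊖n (toℕ i) (toℕ j)))
        (∣m⊖n∣≡∣m-n∣ (toℕ i) (toℕ j))) (ℤ.∣⇒∣ᵤ p∣i-j))))
    where
    small : ∀ {m n} → m ℕ.< p → n ℕ.< p → p ∣ ∣ m - n ∣ → ∣ m - n ∣ ≡ 0
    small {m} {n} m<p n<p p∣ with ∣ m - n ∣ in eq
    ... | ℕ.zero  = ≡.refl
    ... | ℕ.suc _ = contradiction p∣ (ℕ.>⇒∤ (≡.subst (ℕ._< p) eq
      (ℕ.≤-<-trans (ℕ.∣m-n∣≤m⊔n m n) (ℕ.⊔-lub m<p n<p))))

  residue : ℤ → Fin p
  residue a = fromℕ< (ℤ.n%ℕd<d a p)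

  ≈residue : ∀ a → + toℕ (residue a) ≈ a
  ≈residue a = congruent (ℤ.divides (ℤ.- (a ℤ./ℕ p))
    (≡.trans (≡.cong (λ n → + n ℤ.- a) (Fin.toℕ-fromℕ< (ℤ.n%ℕd<d a p)))
      (≡.trans (≡.cong (λ b → + (a ℤ.%ℕ p) ℤ.- b) (ℤ.a≡a%ℕn+[a/ℕn]*n a p))
        (cancel (+ (a ℤ.%ℕ p)) (a ℤ./ℕ p) (+ p)))))
    where
    cancel : ∀ r q d → r ℤ.- (r ℤ.+ q ℤ.* d) ≡ ℤ.- q ℤ.* d
    cancel = solve-∀-ℤ

  residue-cong : ∀ {a b} → a ≈ b → residue a ≡ residue b
  residue-cong a≈b =
    residue-injective (trans (≈residue _) (trans a≈b (sym (≈residue _))))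

  residues : Enumeration setoid p
  residues = record
    { to        = residue
    ; from      = λ i → + toℕ i
    ; to-cong   = residue-cong
    ; from-cong = λ { ≡.refl → refl }
    ; inverse   = (λ a≈i → residue-injective (trans (≈residue _) a≈i))
                , (λ { ≡.refl → ≈residue _ })
    }

  𝔽ₚ : FinitePGroup p
  𝔽ₚ = record
    { group       = +-group
    ; logOrder    = 1
    ; enumeration = reindex (≡.sym (ℕ.^-identityʳ p)) residues
    }

  ×≡* : ∀ n a → RawMonoid._×_ (Group.rawMonoid +-group) n a ≡ + n * a
  ×≡* ℕ.zero    a = ≡.sym (ℤ.*-zeroˡ a)
  ×≡* (ℕ.suc n) a = ≡.trans (≡.cong (λ b → a + b) (×≡* n a)) (step a (+ n))
    where
    step : ∀ a n → a ℤ.+ n ℤ.* a ≡ (1ℤ ℤ.+ n) ℤ.* a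
    step = solve-∀-ℤ

  +*≈0 : ∀ {n} a → p ∣ n → + n * a ≈ 0ℤ
  +*≈0 a p∣n = trans (*-cong (+≈0 p∣n) (refl {a})) (reflexive (ℤ.*-zeroˡ a))

  open Cohomology (𝔽 p) public

  -- Characters, and cochains bounding cup products.

  module _ {G : ProfiniteGroup} where
    private module G = ProfiniteGroup G

    toHom : Cocycle G 1 → ContinuousHomomorphism G (discrete 𝔽ₚ)
    toHom α = toDiscrete G 𝔽ₚ (eval¹ G α) (additive G α) (locallyConstant G α)

    fromHom : ContinuousHomomorphism G (discrete 𝔽ₚ) → Cocycle G 1
    fromHom φ = cocycle¹ G ⟦_⟧ (factors G 𝔽ₚ φ) homo
      where open ContinuousHomomorphism φ

    -- The coboundary equation solved for the value at a product. Equivalently, α, β and -φ are the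
    -- coordinates of a homomorphism to the Heisenberg group.
    record Cobounds (α β : Cocycle G 1) (φ : G.Carrier → ℤ) : Set where
      field
        const  : LocallyConstant G φ
        φ-∙    : ∀ g h → φ (g G.∙ h) ≈ φ g + φ h - eval¹ G α g * eval¹ G β h

    cobounds : ∀ {α β} → _∼ᶜ_ G (_⌣_ G α β) (0ᴴ G) → ∃ (Cobounds α β)
    cobounds {α} {β} (cohomologous (φ , α⌣β≈δφ)) =
      (λ g → Cochain.⟦_⟧ φ (g ∷ [])) , record
      { const = let i , const = Cochain.continuous φ in i , λ e → const (e ∷ [])
      ; φ-∙   = λ g h → solved (eval¹ G α g * eval¹ G β h)
          (Cochain.⟦ φ ⟧ (g ∷ [])) (Cochain.⟦ φ ⟧ (h ∷ []))
          (Cochain.⟦ φ ⟧ (g G.∙ h ∷ [])) (α⌣β≈δφ (g ∷ h ∷ []))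
      }
      where
      solved : ∀ c x y z → c - 0ℤ ≈ y - (z - x) → z ≈ x + y - c
      solved c x y z (congruent d) = congruent (≡.subst (+ p ℤ.∣_) (identity c x y z) d)
        where
        identity : ∀ c x y z → (c ℤ.- 0ℤ) ℤ.- (y ℤ.- (z ℤ.- x)) ≡ z ℤ.- (x ℤ.+ y ℤ.- c)
        identity = solve-∀-ℤ

    eval-^ : ∀ α g n → eval¹ G α (_^_ G g n) ≈ + n * eval¹ G α g
    eval-^ α g n = trans (^-homo (toHom α) g n) (reflexive (×≡* n _))

    eval-ε : ∀ α → eval¹ G α G.ε ≈ 0ℤ
    eval-ε α = ContinuousHomomorphism.ε-homo (toHom α)

    eval-cong : ∀ α {g h} → g G.≈ h → eval¹ G α g ≈ eval¹ G α h
    eval-cong α = ContinuousHomomorphism.⟦⟧-cong (toHom α)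

    -- A locally constant `f` cannot distinguish the p-adic power `x` from a sufficiently late
    -- ordinary power of `g`, whose exponent has the divisibility of a label.
    power-vanishes : ∀ g (l : Label p) {x} → IsPower G g (proj₁ l) x →
      (f : G.Carrier → ℤ) → LocallyConstant G f →
      (∀ n → p ∣ n → p ∣ triangle n → f (_^_ G g n) ≈ 0ℤ) → f x ≈ 0ℤ
    power-vanishes g l g^λ≈x f (i , const) vanishes =
      let n₀ , x∼g^n = g^λ≈x i
          -- Beyond `n₀` the approximation is fine enough for `f`; 2 is the bound in
          -- `label-divisible`.
          n = n₀ ℕ.⊔ 2
          p∣a , p∣t = label-divisible p p-prime l n (ℕ.m≤n⊔m n₀ 2)
      in trans (const (x∼g^n n (ℕ.m≤m⊔n n₀ 2))) (vanishes _ p∣a p∣t)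

    eval-power : ∀ α g (l : Label p) {x} → IsPower G g (proj₁ l) x → eval¹ G α x ≈ 0ℤ
    eval-power α g l g^λ≈x = power-vanishes g l g^λ≈x _ (locallyConstant G α)
      λ n p∣n _ → trans (eval-^ α g n) (+*≈0 _ p∣n)

  module _ {G : ProfiniteGroup} {α β : Cocycle G 1} {φ : ProfiniteGroup.Carrier G → ℤ}
           (cobounds : Cobounds α β φ) where
    private
      module G = ProfiniteGroup G

      a b : G.Carrier → ℤ
      a = eval¹ G α
      b = eval¹ G β
    open Cobounds cobounds
    open ≈-Reasoning setoid

    φ-cong : ∀ {g h} → g G.≈ h → φ g ≈ φ h
    φ-cong e = let i , const = const in const (G.Mod.≈⇒∼ i e)

    φ-ε : φ G.ε ≈ 0ℤ
    φ-ε = cancel (φ G.ε) (b G.ε) (begin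
      φ G.ε                          ≈⟨ φ-cong (G.identityˡ G.ε) ⟨
      φ (G.ε G.∙ G.ε)                ≈⟨ φ-∙ G.ε G.ε ⟩
      φ G.ε + φ G.ε - a G.ε * b G.ε  ≈⟨ +-cong (refl {φ G.ε + φ G.ε})
                                          (-‿cong (*-cong (eval-ε α) (refl {b G.ε}))) ⟩
      φ G.ε + φ G.ε - 0ℤ * b G.ε     ∎)
      where
      cancel : ∀ x y → x ≈ x + x - 0ℤ * y → x ≈ 0ℤ
      cancel x y x≈2x = sym (trans (reflexive (≡.sym (ℤ.+-inverseʳ x)))
        (trans (+-cong x≈2x (refl { - x})) (reflexive (identity x y))))
        where
        identity : ∀ x y → (x ℤ.+ x ℤ.- 0ℤ ℤ.* y) ℤ.- x ≡ x
        identity = solve-∀-ℤ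

    φ-^ : ∀ g n → φ (_^_ G g n) ≈ + n * φ g - + triangle n * (a g * b g)
    φ-^ g ℕ.zero    = trans φ-ε (reflexive (identity (φ g) (a g * b g)))
      where
      identity : ∀ x y → 0ℤ ≡ 0ℤ ℤ.* x ℤ.- 0ℤ ℤ.* y
      identity = solve-∀-ℤ
    φ-^ g (ℕ.suc n) = begin
      φ (g G.∙ _^_ G g n)
        ≈⟨ φ-∙ g (_^_ G g n) ⟩
      φ g + φ (_^_ G g n) - a g * b (_^_ G g n)
        ≈⟨ +-cong (+-cong (refl {φ g}) (φ-^ g n)) (-‿cong (*-cong (refl {a g}) (eval-^ β g n))) ⟩
      φ g + (+ n * φ g - + triangle n * (a g * b g)) - a g * (+ n * b g)
        ≡⟨ identity (+ n) (+ triangle n) (φ g) (a g) (b g) ⟩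
      (1ℤ + + n) * φ g - (+ n + + triangle n) * (a g * b g)
        ∎
      where
      identity : ∀ n t x y z →
        x ℤ.+ (n ℤ.* x ℤ.- t ℤ.* (y ℤ.* z)) ℤ.- y ℤ.* (n ℤ.* z) ≡
        (1ℤ ℤ.+ n) ℤ.* x ℤ.- (n ℤ.+ t) ℤ.* (y ℤ.* z)
      identity = solve-∀-ℤ

    φ-power : ∀ g (l : Label p) {x} → IsPower G g (proj₁ l) x → φ x ≈ 0ℤ
    φ-power g l g^λ≈x = power-vanishes {G} g l g^λ≈x φ const λ n p∣n p∣t →
      trans (φ-^ g n) (+-cong (+*≈0 (φ g) p∣n) (-‿cong (+*≈0 (a g * b g) p∣t)))

    -- The relation says gh = hg·xy, where `φ` and β vanish on xy because the labels are divisible.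
    -- Hence φ(gh) = φ(hg), and comparing the two expansions leaves only the products of α and β.
    cup-symmetric : ∀ g h (l₁ l₂ : Label p) → RelationAt G g h (proj₁ l₁) (proj₁ l₂) →
                    a g * b h ≈ a h * b g
    cup-symmetric g h l₁ l₂ (x , y , g^λ₁≈x , h^λ₂≈y , relation) =
      cancel (φ g) (φ h) (a g * b h) (a h * b g) (a (h G.∙ g)) (begin
        φ g + φ h - a g * b h
          ≈⟨ φ-∙ g h ⟨
        φ (g G.∙ h)
          ≈⟨ φ-cong gh≈hgxy ⟩
        φ ((h G.∙ g) G.∙ (x G.∙ y))
          ≈⟨ φ-∙ (h G.∙ g) (x G.∙ y) ⟩
        φ (h G.∙ g) + φ (x G.∙ y) - a (h G.∙ g) * b (x G.∙ y)
          ≈⟨ +-cong (+-cong (φ-∙ h g) φxy≈0) (-‿cong (*-cong (refl {a (h G.∙ g)}) bxy≈0)) ⟩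
        φ h + φ g - a h * b g + 0ℤ - a (h G.∙ g) * 0ℤ  ∎)
      where
      gh≈hgxy : g G.∙ h G.≈ (h G.∙ g) G.∙ (x G.∙ y)
      gh≈hgxy = G.trans (G.sym (\\-leftDividesˡ (h G.∙ g) (g G.∙ h)))
        (G.∙-congˡ (G.trans (G.∙-congʳ (⁻¹-anti-homo-∙ h g))
          (G.trans (G.sym (G.assoc _ _ _)) relation)))
        where open GroupProperties G.group using (\\-leftDividesˡ; ⁻¹-anti-homo-∙)

      φxy≈0 : φ (x G.∙ y) ≈ 0ℤ
      φxy≈0 = trans (φ-∙ x y) (+-cong
        (+-cong (φ-power g l₁ g^λ₁≈x) (φ-power h l₂ h^λ₂≈y))
        (-‿cong (*-cong (eval-power α g l₁ g^λ₁≈x) (eval-power β h l₂ h^λ₂≈y))))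

      bxy≈0 : b (x G.∙ y) ≈ 0ℤ
      bxy≈0 = trans (additive G β x y)
        (+-cong (eval-power β g l₁ g^λ₁≈x) (eval-power β h l₂ h^λ₂≈y))

      cancel : ∀ u v c d e → u + v - c ≈ v + u - d + 0ℤ - e * 0ℤ → c ≈ d
      cancel u v c d e eq = trans (reflexive (expand u v c))
        (trans (+-cong (refl {u + v}) (-‿cong eq)) (reflexive (collapse u v d e)))
        where
        expand : ∀ u v c → c ≡ u ℤ.+ v ℤ.- (u ℤ.+ v ℤ.- c)
        expand = solve-∀-ℤ
        collapse : ∀ u v d e →
          u ℤ.+ v ℤ.- (v ℤ.+ u ℤ.- d ℤ.+ 0ℤ ℤ.- e ℤ.* 0ℤ) ≡ d
        collapse = solve-∀-ℤ

  -- Characters dual to the generators, and vanishing of α on edges.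

  -- The additive group is abelian of exponent `p` and the labels are divisible by `p`, so both
  -- sides are trivial. Thus any values on the vertices extend to a character.
  relation-𝔽ₚ : ∀ a b (l₁ l₂ : Label p) →
                RelationAt (discrete 𝔽ₚ) a b (proj₁ l₁) (proj₁ l₂)
  relation-𝔽ₚ a b l₁ l₂ =
    0ℤ , 0ℤ , trivial-power a l₁ , trivial-power b l₂ , reflexive (identity a b)
    where
    trivial-power : ∀ a (l : Label p) → IsPower (discrete 𝔽ₚ) a (proj₁ l) 0ℤ
    -- The bound 2 is the one required by `label-divisible`.
    trivial-power a l _ = 2 , λ n 2≤n → trans (+-cong (refl {0ℤ}) (-‿cong
      (trans (reflexive (×≡* (ℤₚ.approx (proj₁ l) n) a))
        (+*≈0 a (proj₁ (label-divisible p p-prime l n 2≤n)))))) refl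

    identity : ∀ a b → ℤ.- a ℤ.+ ℤ.- b ℤ.+ a ℤ.+ b ≡ 0ℤ ℤ.+ 0ℤ
    identity = solve-∀-ℤ

  indicator : ∀ {n} → Fin n → Fin n → ℤ
  indicator i j = if does (i Fin.≟ j) then 1ℤ else 0ℤ

  indicator-refl : ∀ {n} (i : Fin n) → indicator i i ≡ 1ℤ
  indicator-refl i with i Fin.≟ i
  ... | yes _  = ≡.refl
  ... | no i≢i = contradiction ≡.refl i≢i

  indicator-≢ : ∀ {n} {i j : Fin n} → ¬ i ≡ j → indicator i j ≡ 0ℤ
  indicator-≢ {i = i} {j} i≢j with i Fin.≟ j
  ... | yes i≡j = contradiction i≡j i≢j
  ... | no _    = ≡.refl

  module _ (G : ProfiniteGroup) (Γ : DirectedGraph) (f : Labelling p Γ)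
           (presented : IsPresented Γ f G) where
    open DirectedGraph Γ
    open IsPresented presented

    character : Vertex → Cocycle G 1
    character t = fromHom (lift (discrete 𝔽ₚ) (indicator t) (discrete-isPro 𝔽ₚ)
      λ v w e → relation-𝔽ₚ (indicator t v) (indicator t w) (proj₁ (f v w e)) (proj₂ (f v w e)))

    character-ι : ∀ t v → eval¹ G (character t) (ι v) ≈ indicator t v
    character-ι t v = lift-ι (discrete 𝔽ₚ) _ _ _ v

    -- The symmetry of the cup product with the character dual to `w` compares α(v)·1 with α(w)·0;
    -- the character dual to `v` does the same with the ends exchanged. The ends are distinct since
    -- an asymmetric edge relation has no loops.
    𝓡-vanishes : ∀ α → (∀ β → _∼ᶜ_ G (_⌣_ G α β) (0ᴴ G)) → ∀ v w → Edge v w →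
                 eval¹ G α (ι v) ≈ 0ℤ × eval¹ G α (ι w) ≈ 0ℤ
    𝓡-vanishes α α⌣≈0 v w e = first , second
      where
      open ≈-Reasoning setoid
      v≢w : ¬ v ≡ w
      v≢w ≡.refl = asymmetric v v e e

      a : Vertex → ℤ
      a u = eval¹ G α (ι u)

      symmetric : ∀ t → a v * indicator t w ≈ a w * indicator t v
      symmetric t = begin
        a v * indicator t w  ≈⟨ *-cong (refl {a v}) (character-ι t w) ⟨
        a v * χ w            ≈⟨ cup-symmetric (proj₂ (cobounds (α⌣≈0 (character t)))) (ι v) (ι w)
                                  (proj₁ (f v w e)) (proj₂ (f v w e)) (relations v w e) ⟩
        a w * χ v            ≈⟨ *-cong (refl {a w}) (character-ι t v) ⟩
        a w * indicator t v  ∎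
        where
        χ : Vertex → ℤ
        χ u = eval¹ G (character t) (ι u)

      first : a v ≈ 0ℤ
      first = begin
        a v                  ≡⟨ ℤ.*-identityʳ (a v) ⟨
        a v * 1ℤ             ≡⟨ ≡.cong (λ d → a v * d) (indicator-refl w) ⟨
        a v * indicator w w  ≈⟨ symmetric w ⟩
        a w * indicator w v  ≡⟨ ≡.cong (λ d → a w * d) (indicator-≢ (v≢w ∘ ≡.sym)) ⟩
        a w * 0ℤ             ≡⟨ ℤ.*-zeroʳ (a w) ⟩
        0ℤ                   ∎

      second : a w ≈ 0ℤ
      second = begin
        a w                  ≡⟨ ℤ.*-identityʳ (a w) ⟨
        a w * 1ℤ             ≡⟨ ≡.cong (λ d → a w * d) (indicator-refl v) ⟨
        a w * indicator v v  ≈⟨ symmetric v ⟨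
        a v * indicator v w  ≡⟨ ≡.cong (λ d → a v * d) (indicator-≢ v≢w) ⟩
        a v * 0ℤ             ≡⟨ ℤ.*-zeroʳ (a v) ⟩
        0ℤ                   ∎

  open Summation (CommutativeRing.+-commutativeMonoid (𝔽 p)) public
    using (sum; sum-cong-≋; sum-permute; sum-replicate-zero; ∑-distrib-+)

  sum-indicator : ∀ {n} (i : Fin n) c → sum (λ j → c * indicator i j) ≈ c
  sum-indicator {ℕ.suc n} zero c = trans
    (+-cong (reflexive (ℤ.*-identityʳ c)) (trans
      (sum-cong-≋ {n} (λ j → reflexive (ℤ.*-zeroʳ c))) (sum-replicate-zero n)))
    (reflexive (ℤ.+-identityʳ c))
  sum-indicator (suc i) c = trans
    (+-cong (reflexive (ℤ.*-zeroʳ c)) (sum-indicator i c)) (reflexive (ℤ.+-identityˡ c))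

  -- The Heisenberg group over 𝔽ₚ.

  private
    infixl 7 _·_
    _·_ : ℤ × ℤ × ℤ → ℤ × ℤ × ℤ → ℤ × ℤ × ℤ
    (a , b , c) · (a′ , b′ , c′) = a + a′ , b + b′ , c + c′ + a * b′

    ℤ³ : Setoid 0ℓ 0ℓ
    ℤ³ = setoid ×ₛ (setoid ×ₛ setoid)

  -- Upper unitriangular 3×3 matrices, with a and b next to the diagonal and c in the corner.
  heisenberg : FinitePGroup p
  heisenberg = record
    { group = record
      { Carrier = ℤ × ℤ × ℤ
      ; _≈_     = Setoid._≈_ ℤ³
      ; _∙_     = _·_
      ; ε       = 0ℤ , 0ℤ , 0ℤ
      ; _⁻¹     = λ (a , b , c) → - a , - b , - c + a * b
      ; isGroup = record
        { isMonoid = record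
          { isSemigroup = record
            { isMagma = record
              { isEquivalence = Setoid.isEquivalence ℤ³
              ; ∙-cong = λ (e₁ , e₂ , e₃) (e₁′ , e₂′ , e₃′) →
                  +-cong e₁ e₁′ , +-cong e₂ e₂′ , +-cong (+-cong e₃ e₃′) (*-cong e₁ e₂′)
              }
            ; assoc = λ (a , b , c) (a′ , b′ , c′) (a″ , b″ , c″) →
                reflexive (ℤ.+-assoc a a′ a″) , reflexive (ℤ.+-assoc b b′ b″) ,
                reflexive (assoc a b′ c a′ b″ c′ c″)
            }
          ; identity =
              (λ (a , b , c) → reflexive (ℤ.+-identityˡ a) , reflexive (ℤ.+-identityˡ b) ,
                reflexive (identityˡ b c))
            , (λ (a , b , c) → reflexive (ℤ.+-identityʳ a) , reflexive (ℤ.+-identityʳ b) ,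
                reflexive (identityʳ a c))
          }
        ; inverse =
            (λ (a , b , c) → reflexive (ℤ.+-inverseˡ a) , reflexive (ℤ.+-inverseˡ b) ,
              reflexive (inverseˡ a b c))
          , (λ (a , b , c) → reflexive (ℤ.+-inverseʳ a) , reflexive (ℤ.+-inverseʳ b) ,
              reflexive (inverseʳ a b c))
        ; ⁻¹-cong = λ (e₁ , e₂ , e₃) →
            -‿cong e₁ , -‿cong e₂ , +-cong (-‿cong e₃) (*-cong e₁ e₂)
        }
      }
    ; logOrder    = 3
    ; enumeration = reindex (≡.cong (λ n → p ℕ.* (p ℕ.* n)) (≡.sym (ℕ.*-identityʳ p)))
        (×-enumeration residues (×-enumeration residues residues))
    }
    where
    assoc : ∀ a b′ c a′ b″ c′ c″ →
      (c ℤ.+ c′ ℤ.+ a ℤ.* b′) ℤ.+ c″ ℤ.+ (a ℤ.+ a′) ℤ.* b″ ≡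
      c ℤ.+ (c′ ℤ.+ c″ ℤ.+ a′ ℤ.* b″) ℤ.+ a ℤ.* (b′ ℤ.+ b″)
    assoc = solve-∀-ℤ
    identityˡ : ∀ b c → 0ℤ ℤ.+ c ℤ.+ 0ℤ ℤ.* b ≡ c
    identityˡ = solve-∀-ℤ
    identityʳ : ∀ a c → c ℤ.+ 0ℤ ℤ.+ a ℤ.* 0ℤ ≡ c
    identityʳ = solve-∀-ℤ
    inverseˡ : ∀ a b c → (ℤ.- c ℤ.+ a ℤ.* b) ℤ.+ c ℤ.+ (ℤ.- a) ℤ.* b ≡ 0ℤ
    inverseˡ = solve-∀-ℤ
    inverseʳ : ∀ a b c → c ℤ.+ (ℤ.- c ℤ.+ a ℤ.* b) ℤ.+ a ℤ.* (ℤ.- b) ≡ 0ℤ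
    inverseʳ = solve-∀-ℤ

  Hom : FinitePGroup p → FinitePGroup p → Set
  Hom K L = ContinuousHomomorphism (discrete K) (discrete L)

  project-a : Hom heisenberg 𝔽ₚ
  project-a = discreteHom heisenberg 𝔽ₚ proj₁ (λ _ _ → refl) proj₁

  project-b : Hom heisenberg 𝔽ₚ
  project-b = discreteHom heisenberg 𝔽ₚ (proj₁ ∘ proj₂) (λ _ _ → refl) (proj₁ ∘ proj₂)

  -- The corner entry of a product is corrected by `a * b′`, which vanishes for a = 0. So a
  -- character with trivial α-part lifts without any condition.
  include-b : Hom 𝔽ₚ heisenberg
  include-b = discreteHom 𝔽ₚ heisenberg (λ b → 0ℤ , b , 0ℤ)
    (λ b b′ → refl , refl , reflexive (≡.sym (identity b′))) (λ e → refl , e , refl)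
    where
    identity : ∀ b → 0ℤ ℤ.+ 0ℤ ℤ.+ 0ℤ ℤ.* b ≡ 0ℤ
    identity = solve-∀-ℤ

  -- The action on the cosets of U, and wreath products.

  module _ {G : ProfiniteGroup} (S : OpenSubgroup G p) (S-normal : IsNormal S) where
    private
      module G = ProfiniteGroup G
      𝑼 : ProfiniteGroup
      𝑼 = asProfiniteGroup S
      module U = ProfiniteGroup 𝑼
    open OpenSubgroup S
    open HasIndex hasIndex
    open SubgroupProperties.NormalCosets G.group S-normal

    infixl 7 _▹_
    _▹_ : Fin p → G.Carrier → Fin p
    s ▹ g = coset (rep s G.∙ g)

    -- By normality `U` acts trivially on its cosets, so the action depends only on the class of `g`
    -- in G / U, as the wreath product needs.
    ▹-cong : ∀ s {g h} → g ∼ h → s ▹ g ≡ s ▹ h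
    ▹-cong s g∼h = coset-cong hasIndex (∼-congˡ (rep s) g∼h)

    ▹-∙ : ∀ s g h → s ▹ (g G.∙ h) ≡ s ▹ g ▹ h
    ▹-∙ s g h = coset-cong hasIndex
      (∼-trans (≈⇒∼ (G.sym (G.assoc _ _ _))) (∼-congʳ h (rep-coset _)))

    ▹-identity : ∀ s {g} → g ∼ G.ε → s ▹ g ≡ s
    ▹-identity s g∼ε = ≡.trans (▹-cong s g∼ε)
      (rep-injective (∼-trans (∼-sym (rep-coset _)) (≈⇒∼ (G.identityʳ _))))

    ▹-inverseˡ : ∀ s g → s ▹ g G.⁻¹ ▹ g ≡ s
    ▹-inverseˡ s g = ≡.trans (≡.sym (▹-∙ s _ _)) (▹-identity s (≈⇒∼ (G.inverseˡ g)))

    ▹-inverseʳ : ∀ s g → s ▹ g ▹ g G.⁻¹ ≡ s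
    ▹-inverseʳ s g = ≡.trans (≡.sym (▹-∙ s _ _)) (▹-identity s (≈⇒∼ (G.inverseʳ g)))

    ∼-⁻¹-cong : ∀ {g h} → g ∼ h → g G.⁻¹ ∼ h G.⁻¹
    ∼-⁻¹-cong {g} {h} g∼h =
      ∼-trans (≈⇒∼ (G.sym (//-rightDividesʳ h (g G.⁻¹))))
        (∼-trans (∼-congʳ (h G.⁻¹) (∼-congˡ (g G.⁻¹) (∼-sym g∼h)))
          (∼-trans (∼-congʳ (h G.⁻¹) (≈⇒∼ (G.inverseˡ g))) (≈⇒∼ (G.identityˡ _))))
      where open GroupProperties G.group using (//-rightDividesʳ)

    -- s₀ is the coset U itself; its representative need not be ε.
    s₀ : Fin p
    s₀ = coset G.ε

    rep-s₀ : U (rep s₀)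
    rep-s₀ = ε∼⇒∈ (∼-sym (rep-coset G.ε))

    s₀▹rep : ∀ s → s₀ ▹ rep s ≡ s
    s₀▹rep s = ≡.trans (coset-cong hasIndex
      (∼-trans (∼-congʳ (rep s) (∼-sym (rep-coset G.ε))) (≈⇒∼ (G.identityˡ _))))
      (rep-injective (∼-sym (rep-coset _)))

    -- These are the elements over which `cor` sums, so that `cor-α′` can unfold the corestriction.
    step : Fin p → G.Carrier → U.Carrier
    step s g = rep s G.∙ g G.// rep (s ▹ g) , rep-coset (rep s G.∙ g)

    step-∙ : ∀ s g h → step s (g G.∙ h) U.≈ step s g U.∙ step (s ▹ g) h
    step-∙ s g h = G.trans
      (G.reflexive (≡.cong (λ t → rep s G.∙ (g G.∙ h) G.// rep t) (▹-∙ s g h)))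
      (SubgroupProperties.telescope G.group _ _ _ g h)

    step-rep : ∀ s g → proj₁ (step s g) G.∙ rep (s ▹ g) G.≈ rep s G.∙ g
    step-rep s g = GroupProperties.//-rightDividesˡ G.group (rep (s ▹ g)) (rep s G.∙ g)

    -- Once `N k` lies in `U`, moving `g` within its class modulo `N k` does not change the coset
    -- `s ▹ g`, so the same representative is divided out.
    step-mod : ∀ i → ∃ λ k → ∀ s {g h} → g G.≈ h mod k → step s g U.≈ step s h mod i
    step-mod i = let k , k⊆i , k⊆U = G.directed i (proj₁ isOpen) in
      k , λ s {g} {h} g∼h → k⊆i (≡.subst
        (λ t → (rep s G.∙ g G.// rep (s ▹ g)) G.≈ (rep s G.∙ h G.// rep t) mod k)
        (▹-cong s (proj₂ isOpen (k⊆U g∼h)))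
        (G.Mod.∼-congʳ k _ (G.Mod.∼-congˡ k (rep s) g∼h)))

    -- The right G-set G / U replaces the regular action of the quotient group
    -- in the wreath product of K with G / U.
    module _ (K : FinitePGroup p) where
      private module K = FinitePGroup K

      wreath : FinitePGroup p
      wreath = record
        { group = record
          { Carrier = (Fin p → K.Carrier) × G.Carrier
          ; _≈_     = Setoid._≈_ W
          ; _∙_     = λ (f , g) (f′ , g′) → (λ s → f s K.∙ f′ (s ▹ g)) , g G.∙ g′
          ; ε       = (λ _ → K.ε) , G.ε
          ; _⁻¹     = λ (f , g) → (λ s → f (s ▹ g G.⁻¹) K.⁻¹) , g G.⁻¹
          ; isGroup = record
            { isMonoid = record
              { isSemigroup = record
                { isMagma = record
                  { isEquivalence = Setoid.isEquivalence W
                  ; ∙-cong = λ { {y = _ , g} {u = f , _} (e , d) (e′ , d′) →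
                      (λ s → K.∙-cong (e s) (K.trans (K.reflexive (≡.cong f (▹-cong s d)))
                        (e′ (s ▹ g))))
                      , ∼-∙-cong d d′ }
                  }
                ; assoc = λ (f , g) (f′ , g′) (f″ , g″) →
                    (λ s → K.trans (K.assoc _ _ _) (K.∙-congˡ (K.∙-congˡ
                      (K.reflexive (≡.cong f″ (▹-∙ s g g′))))))
                    , ≈⇒∼ (G.assoc g g′ g″)
                }
              ; identity =
                  (λ (f , g) → (λ s → K.trans (K.identityˡ _)
                      (K.reflexive (≡.cong f (▹-identity s ∼-refl))))
                    , ≈⇒∼ (G.identityˡ g))
                , (λ (f , g) → (λ s → K.identityʳ (f s)) , ≈⇒∼ (G.identityʳ g))
              }
            ; inverse =
                (λ (f , g) → (λ s → K.inverseˡ _) , ≈⇒∼ (G.inverseˡ g))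
              , (λ (f , g) → (λ s → K.trans
                    (K.∙-congˡ (K.⁻¹-cong (K.reflexive (≡.cong f (▹-inverseʳ s g)))))
                    (K.inverseʳ (f s)))
                  , ≈⇒∼ (G.inverseʳ g))
            ; ⁻¹-cong = λ { {f , _} {_ , h} (e , d) →
                (λ s → K.⁻¹-cong (K.trans
                  (K.reflexive (≡.cong f (▹-cong s (∼-⁻¹-cong d)))) (e (s ▹ h G.⁻¹))))
                , ∼-⁻¹-cong d }
            }
          }
        ; logOrder    = K.logOrder ℕ.* p ℕ.+ 1
        ; enumeration = reindex order
            (×-enumeration (power-enumeration p K.enumeration) coset-enumeration)
        }
        where
        W : Setoid 0ℓ 0ℓ
        W = Vector.≋-setoid K.setoid p ×ₛ cosets

        coset-enumeration : Enumeration cosets p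
        coset-enumeration = record
          { to        = coset
          ; from      = rep
          ; to-cong   = coset-cong hasIndex
          ; from-cong = λ { ≡.refl → ∼-refl }
          ; inverse   = (λ g∼rep → rep-injective (∼-trans (∼-sym (rep-coset _)) g∼rep))
                      , (λ { ≡.refl → ∼-sym (rep-coset _) })
          }

        order : (p ℕ.^ K.logOrder) ℕ.^ p ℕ.* p ≡ p ℕ.^ (K.logOrder ℕ.* p ℕ.+ 1)
        order = ≡.trans (≡.cong₂ ℕ._*_ (ℕ.^-*-assoc p K.logOrder p) (≡.sym (ℕ.^-identityʳ p)))
          (≡.sym (ℕ.^-distribˡ-+-* p (K.logOrder ℕ.* p) 1))

    wreath-map : ∀ K L → ContinuousHomomorphism (discrete K) (discrete L) →
                 ContinuousHomomorphism (discrete (wreath K)) (discrete (wreath L))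
    wreath-map K L φ = discreteHom (wreath K) (wreath L) (λ (f , g) → φ.⟦_⟧ ∘ f , g)
      (λ _ _ → (λ s → φ.homo _ _) , ∼-refl)
      λ (e , d) → (λ s → φ.⟦⟧-cong (e s)) , d
      where module φ = ContinuousHomomorphism φ

    -- The Kaluzhnin-Krasner map from G to the wreath product of U with G / U, followed by γ in each
    -- coordinate.
    induced : Cocycle 𝑼 1 → ContinuousHomomorphism G (discrete (wreath 𝔽ₚ))
    induced γ = toDiscrete G (wreath 𝔽ₚ) (λ g → (λ s → eval¹ 𝑼 γ (step s g)) , g)
      (λ g h → (λ s → trans (eval-cong γ {step s (g G.∙ h)} {step s g U.∙ step (s ▹ g) h}
                  (step-∙ s g h)) (additive 𝑼 γ (step s g) (step (s ▹ g) h)))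
             , ∼-refl)
      let i , const = locallyConstant 𝑼 γ
          k , step-const = step-mod i
          -- `k` controls the coordinates, and inclusion in `U` controls the component in G / U.
          l , l⊆k , l⊆U = G.directed k (proj₁ isOpen)
      in l , λ g∼h → (λ s → const (step-const s (l⊆k g∼h))) , proj₂ isOpen (l⊆U g∼h)

    -- Lifting to the wreath product of the Heisenberg group, and the preimage of α.

    module _ (Γ : DirectedGraph) (f : Labelling p Γ) (presented : IsPresented Γ f G)
             (α : Cocycle G 1) (α⌣≈0 : ∀ β → _∼ᶜ_ G (_⌣_ G α β) (0ᴴ G)) where
      open DirectedGraph Γ using (Vertex)
      open IsPresented presented
      private
        module 𝑾 = FinitePGroup (wreath heisenberg)

        a : Vertex → ℤ
        a v = eval¹ G α (ι v)

      -- Concentrating α(v) at one coset makes the a-coordinates sum to α(v), the value that the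
      -- corestriction has to return. The b-coordinates are those of `induced β`; the corner entries
      -- may be chosen freely.
      target : Cocycle 𝑼 1 → Vertex → 𝑾.Carrier
      target β v = (λ s → a v * indicator s₀ s , eval¹ 𝑼 β (step s (ι v)) , 0ℤ) , ι v

      -- α vanishes at the ends of an edge, where target β is therefore the
      -- image of ι under a homomorphism defined on all of G.
      target-relations : ∀ β → Relations Γ f (discrete (wreath heisenberg)) (target β)
      target-relations β v w e =
        let λ₁ , λ₂ = f v w e
            av≈0 , aw≈0 = 𝓡-vanishes G Γ f presented α α⌣≈0 v w e
        in RelationAt-cong (discrete (wreath heisenberg)) (proj₁ λ₁) (proj₁ λ₂)
             (agree v av≈0) (agree w aw≈0)
             (RelationAt-homo φ (ι v) (ι w) (proj₁ λ₁) (proj₁ λ₂) (relations v w e))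
        where
        φ : ContinuousHomomorphism G (discrete (wreath heisenberg))
        φ = wreath-map 𝔽ₚ heisenberg include-b ∘ʰ induced β

        agree : ∀ v → a v ≈ 0ℤ → ContinuousHomomorphism.⟦_⟧ φ (ι v) 𝑾.≈ target β v
        agree v av≈0 =
          (λ s → sym (trans (*-cong av≈0 (refl {indicator s₀ s}))
                   (reflexive (ℤ.*-zeroˡ (indicator s₀ s)))) , refl , refl)
          , ∼-refl

      abstract
        lifting : Cocycle 𝑼 1 → ContinuousHomomorphism G (discrete (wreath heisenberg))
        lifting β = lift (discrete (wreath heisenberg)) (target β)
          (discrete-isPro (wreath heisenberg)) (target-relations β)

        lifting-ι : ∀ β v → ContinuousHomomorphism.⟦_⟧ (lifting β) (ι v) 𝑾.≈ target β v
        lifting-ι β = lift-ι (discrete (wreath heisenberg)) (target β)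
          (discrete-isPro (wreath heisenberg)) (target-relations β)

      module _ (β : Cocycle 𝑼 1) where
        open ContinuousHomomorphism (lifting β)

        ⟦_⟧ᵃ ⟦_⟧ᵇ ⟦_⟧ᶜ : G.Carrier → Fin p → ℤ
        ⟦ g ⟧ᵃ s = proj₁ (proj₁ ⟦ g ⟧ s)
        ⟦ g ⟧ᵇ s = proj₁ (proj₂ (proj₁ ⟦ g ⟧ s))
        ⟦ g ⟧ᶜ s = proj₂ (proj₂ (proj₁ ⟦ g ⟧ s))

        lifting-base : G.Carrier → G.Carrier
        lifting-base g = proj₂ ⟦ g ⟧

        -- Both homomorphisms agree on the generators, hence everywhere: the lift really lies over
        -- β.
        lifting-b : ∀ g → (∀ s → ⟦ g ⟧ᵇ s ≈ eval¹ 𝑼 β (step s g)) × lifting-base g ∼ g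
        lifting-b = unique (discrete (wreath 𝔽ₚ)) (discrete-isPro (wreath 𝔽ₚ))
          (wreath-map heisenberg 𝔽ₚ project-b ∘ʰ lifting β) (induced β)
          λ v → (λ s → proj₁ (proj₂ (proj₁ (lifting-ι β v) s))) , proj₂ (lifting-ι β v)

        lifting-∙ : ∀ g h s →
          ⟦ g G.∙ h ⟧ᵃ s ≈ ⟦ g ⟧ᵃ s + ⟦ h ⟧ᵃ (s ▹ g) ×
          ⟦ g G.∙ h ⟧ᶜ s ≈ ⟦ g ⟧ᶜ s + ⟦ h ⟧ᶜ (s ▹ g) + ⟦ g ⟧ᵃ s * ⟦ h ⟧ᵇ (s ▹ g)
        lifting-∙ g h s = ≡.subst
          (λ t → ⟦ g G.∙ h ⟧ᵃ s ≈ ⟦ g ⟧ᵃ s + ⟦ h ⟧ᵃ t ×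
                 ⟦ g G.∙ h ⟧ᶜ s ≈ ⟦ g ⟧ᶜ s + ⟦ h ⟧ᶜ t + ⟦ g ⟧ᵃ s * ⟦ h ⟧ᵇ t)
          -- The group law of the wreath product shifts by `lifting-base g`, which lies in the coset
          -- of `g`.
          (▹-cong s (proj₂ (lifting-b g)))
          (let e = proj₁ (homo g h) s in proj₁ e , proj₂ (proj₂ e))

      -- The a-coordinates of `target` do not mention β, so uniqueness makes those of the lift
      -- independent of β. A single class α′ can therefore serve for all β.
      lifting-a : ∀ β γ g → (∀ s → ⟦ β ⟧ᵃ g s ≈ ⟦ γ ⟧ᵃ g s) ×
                  lifting-base β g ∼ lifting-base γ g
      lifting-a β γ = unique (discrete (wreath 𝔽ₚ)) (discrete-isPro (wreath 𝔽ₚ))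
        (wreath-map heisenberg 𝔽ₚ project-a ∘ʰ lifting β)
        (wreath-map heisenberg 𝔽ₚ project-a ∘ʰ lifting γ)
        λ v → agree v , base v
        where
        agree : ∀ v s → ⟦ β ⟧ᵃ (ι v) s ≈ ⟦ γ ⟧ᵃ (ι v) s
        agree v s = trans {j = a v * indicator s₀ s} (proj₁ (proj₁ (lifting-ι β v) s))
          (sym (proj₁ (proj₁ (lifting-ι γ v) s)))

        base : ∀ v → lifting-base β (ι v) ∼ lifting-base γ (ι v)
        base v = ∼-trans {h = ι v} (proj₂ (lifting-ι β v)) (∼-sym (proj₂ (lifting-ι γ v)))

      -- The common a-part of all the lifts, read off from the one for β = 0.
      D : G.Carrier → Fin p → ℤ
      D = ⟦ 0ᴴ 𝑼 ⟧ᵃ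

      D-const : ∃ λ i → ∀ {g h} → g G.≈ h mod i → ∀ s → D g s ≈ D h s
      D-const = let i , const = factors G (wreath heisenberg) (lifting (0ᴴ 𝑼)) in
        i , λ g∼h s → proj₁ (proj₁ (const g∼h) s)

      D-∙ : ∀ g h s → D (g G.∙ h) s ≈ D g s + D h (s ▹ g)
      D-∙ g h s = proj₁ (lifting-∙ (0ᴴ 𝑼) g h s)

      -- Shapiro's correspondence: `U` fixes the coset `s₀`, so the crossed homomorphism `D` is
      -- additive there when restricted to `U`.
      α′ : Cocycle 𝑼 1
      α′ = cocycle¹ 𝑼 (λ (u , _) → D u s₀)
        (let i , const = D-const in i , λ u∼v → const u∼v s₀)
        λ (u , u∈U) (v , _) → trans (D-∙ u v s₀)
          (reflexive (≡.cong (λ s → D u s₀ + D v s) (▹-identity s₀ (∈⇒ε∼ u∈U))))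

      -- On `U` the coordinate at `s₀` of `lifting β` is a homomorphism to the Heisenberg group over
      -- α′ and β. Its corner entry bounds the cup product, with a minus sign from the convention
      -- for `δ`.
      α′⌣≈0 : ∀ β → _∼ᶜ_ 𝑼 (_⌣_ 𝑼 α′ β) (0ᴴ 𝑼)
      α′⌣≈0 β = cohomologous
        ( cochain¹ 𝑼 (λ (u , _) → - ⟦ β ⟧ᶜ u s₀)
            (let i , const = factors G (wreath heisenberg) (lifting β) in
             i , λ u∼v → -‿cong (proj₂ (proj₂ (proj₁ (const u∼v) s₀))))
        , λ { (u ∷ v ∷ []) → solved (D (proj₁ u) s₀ * eval¹ 𝑼 β v)
                (⟦ β ⟧ᶜ (proj₁ u) s₀) (⟦ β ⟧ᶜ (proj₁ v) s₀) (⟦ β ⟧ᶜ (proj₁ u G.∙ proj₁ v) s₀)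
                (c-∙ u v) }
        )
        where
        s₀▹ : ∀ (u : U.Carrier) → s₀ ▹ proj₁ u ≡ s₀
        s₀▹ (u , u∈U) = ▹-identity s₀ (∈⇒ε∼ u∈U)

        r₀ : U.Carrier
        r₀ = rep s₀ , rep-s₀

        -- Here `step s₀` is conjugation by `rep s₀`, which lies in `U`, and β is additive with
        -- values in an abelian group.
        β-step : ∀ v → eval¹ 𝑼 β (step s₀ (proj₁ v)) ≈ eval¹ 𝑼 β v
        β-step v = ∙-cancelʳ (eval¹ 𝑼 β r₀) _ _ (begin
          eval¹ 𝑼 β (step s₀ (proj₁ v)) + eval¹ 𝑼 β r₀  ≈⟨ additive 𝑼 β (step s₀ (proj₁ v)) r₀ ⟨
          eval¹ 𝑼 β (step s₀ (proj₁ v) U.∙ r₀)          ≈⟨ eval-cong β {step s₀ (proj₁ v) U.∙ r₀} {r₀ U.∙ v}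
                                                              conjugate ⟩
          eval¹ 𝑼 β (r₀ U.∙ v)                          ≈⟨ additive 𝑼 β r₀ v ⟩
          eval¹ 𝑼 β r₀ + eval¹ 𝑼 β v                    ≡⟨ ℤ.+-comm (eval¹ 𝑼 β r₀) (eval¹ 𝑼 β v) ⟩
          eval¹ 𝑼 β v + eval¹ 𝑼 β r₀                    ∎)
          where
          open ≈-Reasoning setoid
          open GroupProperties +-group using (∙-cancelʳ)
          conjugate : proj₁ (step s₀ (proj₁ v)) G.∙ rep s₀ G.≈ rep s₀ G.∙ proj₁ v
          conjugate = ≡.subst
            (λ s → proj₁ (step s₀ (proj₁ v)) G.∙ rep s G.≈ rep s₀ G.∙ proj₁ v)
            (s₀▹ v) (step-rep s₀ (proj₁ v))

        c-∙ : ∀ u v → ⟦ β ⟧ᶜ (proj₁ u G.∙ proj₁ v) s₀ ≈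
              ⟦ β ⟧ᶜ (proj₁ u) s₀ + ⟦ β ⟧ᶜ (proj₁ v) s₀ + D (proj₁ u) s₀ * eval¹ 𝑼 β v
        c-∙ u v = trans
          (≡.subst (λ s → ⟦ β ⟧ᶜ (proj₁ u G.∙ proj₁ v) s₀ ≈
                   ⟦ β ⟧ᶜ (proj₁ u) s₀ + ⟦ β ⟧ᶜ (proj₁ v) s +
                   ⟦ β ⟧ᵃ (proj₁ u) s₀ * ⟦ β ⟧ᵇ (proj₁ v) s)
            (s₀▹ u) (proj₂ (lifting-∙ β (proj₁ u) (proj₁ v) s₀)))
          (+-cong (refl {⟦ β ⟧ᶜ (proj₁ u) s₀ + ⟦ β ⟧ᶜ (proj₁ v) s₀})
            (*-cong (proj₁ (lifting-a β (0ᴴ 𝑼) (proj₁ u)) s₀)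
              (trans (proj₁ (lifting-b β (proj₁ v)) s₀) (β-step v))))

        solved : ∀ c x y z → z ≈ x + y + c → c - 0ℤ ≈ - y - (- z - - x)
        solved c x y z (congruent d) = congruent (≡.subst (+ p ℤ.∣_) (identity c x y z) (ℤ.∣m⇒∣-m d))
          where
          identity : ∀ c x y z → ℤ.- (z ℤ.- (x ℤ.+ y ℤ.+ c)) ≡
                     (c ℤ.- 0ℤ) ℤ.- (ℤ.- y ℤ.- (ℤ.- z ℤ.- ℤ.- x))
          identity = solve-∀-ℤ

      -- Evaluate `D` at the coset `s₀` on the two factorizations of `rep s G.∙ g`. So α′ on the
      -- steps is `D g` up to a difference of values at representatives.
      D-step : ∀ s g → eval¹ 𝑼 α′ (step s g) + D (rep (s ▹ g)) s₀ ≈ D (rep s) s₀ + D g s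
      D-step s g = begin
        D u s₀ + D (rep (s ▹ g)) s₀
          ≡⟨ ≡.cong (λ t → D u s₀ + D (rep (s ▹ g)) t) (▹-identity s₀ (∈⇒ε∼ (proj₂ (step s g)))) ⟨
        D u s₀ + D (rep (s ▹ g)) (s₀ ▹ u)
          ≈⟨ D-∙ u (rep (s ▹ g)) s₀ ⟨
        D (u G.∙ rep (s ▹ g)) s₀
          ≈⟨ (let i , const = D-const in const (G.Mod.≈⇒∼ i (step-rep s g)) s₀) ⟩
        D (rep s G.∙ g) s₀
          ≈⟨ D-∙ (rep s) g s₀ ⟩
        D (rep s) s₀ + D g (s₀ ▹ rep s)
          ≡⟨ ≡.cong (λ t → D (rep s) s₀ + D g t) (s₀▹rep s) ⟩
        D (rep s) s₀ + D g s
          ∎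
        where
        open ≈-Reasoning setoid
        u : G.Carrier
        u = proj₁ (step s g)

      sum-▹ : ∀ (x : Fin p → ℤ) g → sum x ≈ sum (λ s → x (s ▹ g))
      sum-▹ x g = sum-permute x
        (permutation (_▹ g) (_▹ (g G.⁻¹)) (λ s → ▹-inverseˡ s g) (λ s → ▹-inverseʳ s g))

      -- In the sum over all cosets the correction terms `E` of `D-step` cancel, since `g` permutes
      -- the cosets.
      cor-α′ : ∀ g → eval¹ G (Func.to (cor S) α′) g ≈ sum (D g)
      cor-α′ g = ∙-cancelʳ (sum E) _ _ (begin
        sum (λ s → eval¹ 𝑼 α′ (step s g)) + sum E
          ≈⟨ +-cong (refl {sum (λ s → eval¹ 𝑼 α′ (step s g))}) (sum-▹ E g) ⟩
        sum (λ s → eval¹ 𝑼 α′ (step s g)) + sum (λ s → E (s ▹ g))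
          ≈⟨ ∑-distrib-+ (λ s → eval¹ 𝑼 α′ (step s g)) (λ s → E (s ▹ g)) ⟨
        sum (λ s → eval¹ 𝑼 α′ (step s g) + E (s ▹ g))
          ≈⟨ sum-cong-≋ (λ s → D-step s g) ⟩
        sum (λ s → E s + D g s)
          ≈⟨ ∑-distrib-+ E (D g) ⟩
        sum E + sum (D g)
          ≡⟨ ℤ.+-comm (sum E) (sum (D g)) ⟩
        sum (D g) + sum E
          ∎)
        where
        open ≈-Reasoning setoid
        open GroupProperties +-group using (∙-cancelʳ)
        E : Fin p → ℤ
        E s = D (rep s) s₀

      -- It is enough to compare values on generators, where the a-coordinates are α(v) at `s₀` and
      -- 0 elsewhere.
      cor-α′∼α : _∼ᶜ_ G (Func.to (cor S) α′) α
      cor-α′∼α = ≈⇒∼ᶜ G (unique (discrete 𝔽ₚ) (discrete-isPro 𝔽ₚ)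
        (toHom (Func.to (cor S) α′)) (toHom α) λ v →
          trans (cor-α′ (ι v)) (trans
            (sum-cong-≋ λ s → proj₁ (proj₁ (lifting-ι (0ᴴ 𝑼) v) s))
            (sum-indicator s₀ (a v))))

  kijimaNishi-raag : ∀ {G} → IsGeneralizedRAAG p G → KijimaNishi p G
  kijimaNishi-raag {G} (Γ , f , presented) S S-normal (α , α⌣≈0) =
    (α′ S S-normal Γ f presented α α⌣≈0 , α′⌣≈0 S S-normal Γ f presented α α⌣≈0) ,
    λ {γ} γ∼α′ → Setoid.trans (H G 1)
      {Func.to (cor S) (proj₁ γ)}
      {Func.to (cor S) (α′ S S-normal Γ f presented α α⌣≈0)} {α}
      (Func.cong (cor S) {proj₁ γ} {α′ S S-normal Γ f presented α α⌣≈0} γ∼α′)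
      (cor-α′∼α S S-normal Γ f presented α α⌣≈0)

  -- Semidirect products with Δ.

  module _ (2≈0 : + 2 ≈ 0ℤ) {A : ProfiniteGroup} (a : AutomorphismOfOrderTwo A) where
    private
      module A = ProfiniteGroup A
      module a = AutomorphismOfOrderTwo a
      A⋊Δ : ProfiniteGroup
      A⋊Δ = semidirectProduct A a
      module A⋊Δ = ProfiniteGroup A⋊Δ

    x+x≈0 : ∀ x → x + x ≈ 0ℤ
    x+x≈0 x = trans (reflexive (double x)) (trans (*-cong 2≈0 (refl {x}))
      (reflexive (ℤ.*-zeroˡ x)))
      where
      double : ∀ x → x ℤ.+ x ≡ + 2 ℤ.* x
      double = solve-∀-ℤ

    -- The character with kernel A; its additivity on the nontrivial coset needs 2 = 0.
    sign : Cocycle A⋊Δ 1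
    sign = cocycle¹ A⋊Δ (bit ∘ proj₂)
      (A⋊Δ.inhabited , λ {(_ , s)} {(_ , t)} e → reflexive (≡.cong bit (xor-≡ s t (proj₂ e))))
      λ (_ , s) (_ , t) → bit-xor s t
      where
      bit : Bool → ℤ
      bit s = if s then 1ℤ else 0ℤ

      xor-≡ : ∀ s t → s xor t ≡ false → s ≡ t
      xor-≡ false t     e      = ≡.sym e
      xor-≡ true  true  e      = ≡.refl

      bit-xor : ∀ s t → bit (s xor t) ≈ bit s + bit t
      bit-xor false t     = reflexive (≡.sym (ℤ.+-identityˡ (bit t)))
      bit-xor true  false = refl
      bit-xor true  true  = sym 2≈0

    module _ {G : ProfiniteGroup} (G≅A⋊Δ : G ≅ A⋊Δ) where
      private
        module G = ProfiniteGroup G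
        open _≅_ G≅A⋊Δ
        module to = ContinuousHomomorphism to
        module from = ContinuousHomomorphism from

        η : ContinuousHomomorphism A G
        η = from ∘ʰ embed a
        module η = ContinuousHomomorphism η

        x₀ : G.Carrier
        x₀ = from.⟦ A.ε , true ⟧

        χ₀ : Cocycle G 1
        χ₀ = fromHom (toHom sign ∘ʰ to)

      χ₀-from : ∀ y → eval¹ G χ₀ from.⟦ y ⟧ ≈ eval¹ A⋊Δ sign y
      χ₀-from y = eval-cong sign (to∘from y)

      x₀-conjugation : ∀ g → x₀ G.∙ η.⟦ g ⟧ G.≈ η.⟦ a.⟦ g ⟧ ⟧ G.∙ x₀
      x₀-conjugation g = G.trans (G.sym (from.homo _ _)) (G.trans
        (from.⟦⟧-cong (A.trans (A.identityˡ a.⟦ g ⟧) (A.sym (A.identityʳ a.⟦ g ⟧)) , ≡.refl))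
        (from.homo _ _))

      x₀²≈ε : x₀ G.∙ x₀ G.≈ G.ε
      x₀²≈ε = G.trans (G.sym (from.homo _ _)) (G.trans
        (from.⟦⟧-cong (A.trans (A.identityˡ _) a.ε-homo , ≡.refl)) from.ε-homo)

      from-true : ∀ g → from.⟦ g , true ⟧ G.≈ η.⟦ g ⟧ G.∙ x₀
      from-true g = G.trans (from.⟦⟧-cong (A.sym (A.identityʳ g) , ≡.refl)) (from.homo _ _)

      module _ (α : Cocycle G 1) (α⌣≈0 : ∀ β → _∼ᶜ_ G (_⌣_ G α β) (0ᴴ G)) where
        private
          cup : ∃ (Cobounds α χ₀)
          cup = cobounds (α⌣≈0 χ₀)

          φ : G.Carrier → ℤ
          φ = proj₁ cup
          open Cobounds (proj₂ cup)
          open ≈-Reasoning setoid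

          ev : G.Carrier → ℤ
          ev = eval¹ G α

        -- `χ₀` vanishes on A, so the cup product contributes nothing.
        φ-∙η : ∀ g h → φ (g G.∙ η.⟦ h ⟧) ≈ φ g + φ η.⟦ h ⟧
        φ-∙η g h = trans (φ-∙ g η.⟦ h ⟧) (trans
          (+-cong (refl {φ g + φ η.⟦ h ⟧})
            (-‿cong (*-cong (refl {ev g}) (χ₀-from (h , false)))))
          (reflexive (identity (φ g) (φ η.⟦ h ⟧) (ev g))))
          where
          identity : ∀ x y z → x ℤ.+ y ℤ.- z ℤ.* 0ℤ ≡ x ℤ.+ y
          identity = solve-∀-ℤ

        φ-∙x₀ : ∀ g → φ (g G.∙ x₀) ≈ φ g + φ x₀ - ev g
        φ-∙x₀ g = trans (φ-∙ g x₀) (+-cong (refl {φ g + φ x₀}) (-‿cong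
          (trans (*-cong (refl {ev g}) (χ₀-from (A.ε , true))) (reflexive (ℤ.*-identityʳ (ev g))))))

        -- Since χ₀(x₀) = 1, expanding φ(x₀x₀) = φ(ε) = 0 gives 2φ(x₀) - α(x₀) = 0.
        ev-x₀ : ev x₀ ≈ 0ℤ
        ev-x₀ = begin
          ev x₀                       ≡⟨ identity (φ x₀) (ev x₀) ⟩
          φ x₀ + φ x₀ - (φ x₀ + φ x₀ - ev x₀)
            ≈⟨ +-cong (x+x≈0 (φ x₀)) (-‿cong (trans (sym (φ-∙x₀ x₀))
                 (trans (φ-cong (proj₂ cup) x₀²≈ε) (φ-ε (proj₂ cup))))) ⟩
          0ℤ - 0ℤ                     ∎
          where
          identity : ∀ x y → y ≡ x ℤ.+ x ℤ.- (x ℤ.+ x ℤ.- y)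
          identity = solve-∀-ℤ

        φη : ContinuousHomomorphism A (discrete 𝔽ₚ)
        φη = toDiscrete A 𝔽ₚ (φ ∘ η.⟦_⟧)
          (λ g h → trans (φ-cong (proj₂ cup) (η.homo g h)) (φ-∙η η.⟦ g ⟧ h))
          (let i , const = const ; j , j⊆i = η.continuous i in
            j , λ g∼h → const (mod-homo η {j} {i} j⊆i g∼h))

        hom-conjugate : ∀ (θ : ContinuousHomomorphism A (discrete 𝔽ₚ)) z g →
          ContinuousHomomorphism.⟦_⟧ θ (z A.∙ g A.⁻¹ A.∙ z A.⁻¹) ≈
          - ContinuousHomomorphism.⟦_⟧ θ g
        hom-conjugate θ z g = begin
          ⟦ z A.∙ g A.⁻¹ A.∙ z A.⁻¹ ⟧         ≈⟨ homo _ _ ⟩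
          ⟦ z A.∙ g A.⁻¹ ⟧ + ⟦ z A.⁻¹ ⟧       ≈⟨ +-cong (homo _ _) (⁻¹-homo z) ⟩
          ⟦ z ⟧ + ⟦ g A.⁻¹ ⟧ + - ⟦ z ⟧        ≈⟨ +-cong (+-cong (refl {⟦ z ⟧}) (⁻¹-homo g)) (refl { - ⟦ z ⟧}) ⟩
          ⟦ z ⟧ + - ⟦ g ⟧ + - ⟦ z ⟧           ≡⟨ identity ⟦ z ⟧ ⟦ g ⟧ ⟩
          - ⟦ g ⟧                             ∎
          where
          open ContinuousHomomorphism θ
          identity : ∀ x y → x ℤ.+ ℤ.- y ℤ.+ ℤ.- x ≡ ℤ.- y
          identity = solve-∀-ℤ

        -- Expand `φ` on both sides of x₀·g = a(g)·x₀. Characters of A send a(g) to the negative of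
        -- their value at `g`, and `φ` restricted to A is one of them; this leaves α(g) = 2φ(g).
        ev-inverted : ∀ g z → a.⟦ g ⟧ A.≈ z A.∙ g A.⁻¹ A.∙ z A.⁻¹ → ev η.⟦ g ⟧ ≈ 0ℤ
        ev-inverted g z ag≈ = begin
          ev η.⟦ g ⟧
            ≡⟨ expand (ev η.⟦ g ⟧) (φ η.⟦ g ⟧) (φ x₀) ⟩
          (φ η.⟦ g ⟧ + φ η.⟦ g ⟧) + ((- φ η.⟦ g ⟧ + φ x₀ - - ev η.⟦ g ⟧) - (φ x₀ + φ η.⟦ g ⟧))
            ≈⟨ +-cong (x+x≈0 (φ η.⟦ g ⟧)) (+-cong conjugate (refl { - (φ x₀ + φ η.⟦ g ⟧)})) ⟩
          0ℤ + ((φ x₀ + φ η.⟦ g ⟧) - (φ x₀ + φ η.⟦ g ⟧))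
            ≡⟨ collapse (φ x₀ + φ η.⟦ g ⟧) ⟩
          0ℤ  ∎
          where
          h : A.Carrier
          h = a.⟦ g ⟧

          φηh : φ η.⟦ h ⟧ ≈ - φ η.⟦ g ⟧
          φηh = trans (ContinuousHomomorphism.⟦⟧-cong φη ag≈) (hom-conjugate φη z g)

          evηh : ev η.⟦ h ⟧ ≈ - ev η.⟦ g ⟧
          evηh = trans (ContinuousHomomorphism.⟦⟧-cong (toHom α ∘ʰ η) ag≈)
            (hom-conjugate (toHom α ∘ʰ η) z g)

          conjugate : - φ η.⟦ g ⟧ + φ x₀ - - ev η.⟦ g ⟧ ≈ φ x₀ + φ η.⟦ g ⟧
          conjugate = begin
            - φ η.⟦ g ⟧ + φ x₀ - - ev η.⟦ g ⟧  ≈⟨ +-cong (+-cong φηh (refl {φ x₀})) (-‿cong evηh) ⟨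
            φ η.⟦ h ⟧ + φ x₀ - ev η.⟦ h ⟧      ≈⟨ φ-∙x₀ η.⟦ h ⟧ ⟨
            φ (η.⟦ h ⟧ G.∙ x₀)                 ≈⟨ φ-cong (proj₂ cup) (x₀-conjugation g) ⟨
            φ (x₀ G.∙ η.⟦ g ⟧)                 ≈⟨ φ-∙η x₀ g ⟩
            φ x₀ + φ η.⟦ g ⟧                   ∎

          expand : ∀ e x y → e ≡ (x ℤ.+ x) ℤ.+ ((ℤ.- x ℤ.+ y ℤ.- ℤ.- e) ℤ.- (y ℤ.+ x))
          expand = solve-∀-ℤ
          collapse : ∀ x → 0ℤ ℤ.+ (x ℤ.- x) ≡ 0ℤ
          collapse = solve-∀-ℤ

        module _ {Γ : DirectedGraph} {f : Labelling p Γ} (presented : IsPresented Γ f A)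
                 (z : DirectedGraph.Vertex Γ → A.Carrier)
                 (a-ι : ∀ v → a.⟦ IsPresented.ι presented v ⟧ A.≈
                   z v A.∙ IsPresented.ι presented v A.⁻¹ A.∙ z v A.⁻¹) where
          open IsPresented presented

          ev-η : ∀ g → ev η.⟦ g ⟧ ≈ 0ℤ
          ev-η = unique (discrete 𝔽ₚ) (discrete-isPro 𝔽ₚ) (toHom α ∘ʰ η) (toHom (0ᴴ A))
            λ v → ev-inverted (ι v) (z v) (a-ι v)

          ev-from : ∀ y → ev from.⟦ y ⟧ ≈ 0ℤ
          ev-from (g , false) = ev-η g
          ev-from (g , true)  = trans (eval-cong α (from-true g))
            (trans (additive G α η.⟦ g ⟧ x₀) (+-cong (ev-η g) ev-x₀))

          𝓡-trivial : _∼ᶜ_ G α (0ᴴ G)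
          𝓡-trivial = ≈⇒∼ᶜ G λ g →
            trans (eval-cong α (G.sym (from∘to g))) (ev-from to.⟦ g ⟧)

  -- When the only class cupping trivially with everything is zero, the zero class of `U` is a
  -- preimage.
  kijimaNishi-trivial : ∀ {G} → (∀ α → (∀ β → _∼ᶜ_ G (_⌣_ G α β) (0ᴴ G)) → _∼ᶜ_ G α (0ᴴ G)) →
                        KijimaNishi p G
  kijimaNishi-trivial {G} trivial S _ (α , α⌣≈0) =
    (0ᴴ 𝑼 , λ β → ≈0⇒∼ (λ { (u ∷ v ∷ []) → ℤ.*-zeroˡ (eval¹ 𝑼 β v) })) ,
    λ {γ} γ∼0 → Setoid.trans (H G 1) {Func.to (cor S) (proj₁ γ)} {Func.to (cor S) (0ᴴ 𝑼)} {α}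
      (Func.cong (cor S) {proj₁ γ} {0ᴴ 𝑼} γ∼0)
      (Setoid.trans (H G 1) {Func.to (cor S) (0ᴴ 𝑼)} {0ᴴ G} {α}
        (≈⇒∼ᶜ G λ _ → sum-replicate-zero p)
        (Setoid.sym (H G 1) {α} {0ᴴ G} (trivial α α⌣≈0)))
    where
    𝑼 : ProfiniteGroup
    𝑼 = asProfiniteGroup S

    ≈0⇒∼ : ∀ {κ : Cocycle 𝑼 2} → (∀ us → Cocycle.⟦_⟧ κ us ≡ 0ℤ) → _∼ᶜ_ 𝑼 κ (0ᴴ 𝑼)
    ≈0⇒∼ κ≡0 = cohomologous (coboundary-zero 𝑼 λ us →
      reflexive (≡.cong (λ a → a - 0ℤ) (κ≡0 us)))

kijimaNishi-Δ : Prime 2 → ∀ {G} → IsΔRAAG G → KijimaNishi 2 G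
kijimaNishi-Δ 2-prime ΔRAAG = kijimaNishi-trivial 2 2-prime λ α α⌣≈0 →
  𝓡-trivial 2 2-prime (+≈0 2 2-prime (ℕ.divides 1 ≡.refl)) a iso α α⌣≈0 isRAAG z a-ι
  where
  open IsΔRAAG ΔRAAG
  open ModP

theorem4 : (p : ℕ) → Prime p → (G : ProfiniteGroup) → IsPro p G →
    (IsGeneralizedRAAG p G ⊎ (p ≡ 2 × IsΔRAAG G)) → KijimaNishi p G
theorem4 p p-prime G _ (inj₁ raag)             = ModP.kijimaNishi-raag p p-prime raag
theorem4 p p-prime G _ (inj₂ (≡.refl , ΔRAAG)) = kijimaNishi-Δ p-prime ΔRAAG
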